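{- Let $m,\ell\ge1$ and $N=m\ell+2$. For every $(m+2)$-angulation $T$ of the polygon $P_N$, $\mathsf{brow}(\sigma(T))=\widetilde{\mathsf{rot}}(\mathsf{brow}(T))$; that is, $\mathsf{brow}\circ\sigma=\widetilde{\mathsf{rot}}\circ\mathsf{brow}$ as maps from $(m+2)$-angulations of $P_N$ to $m$-Dyck paths of order $\ell$.
   Context: $P_N$ has vertices $v_0,\ldots,v_{N-1}$ in clockwise order; $\sigma$ is the counterclockwise rotation $v_i\mapsto v_{i-1}$, so $\sigma(T)$ contains $(v_{i-1},v_{j-1})$ iff $T$ contains $(v_i,v_j)$. An $(m+2)$-angulation is a set of non-crossing diagonals cutting $P_N$ into $(m+2)$-gons (subgons). An $m$-Dyck path of order $\ell$ is a word in $U$ (step $(0,1)$) and $R$ (step $(1,0)$) giving a lattice path from $(0,0)$ to $(m\ell,\ell)$ staying weakly above $y=x/m$. The browse map: $\mathsf{brow}(T)$ is the word obtained by visiting $v_0,v_1,\ldots,v_{N-1}$ in this (clockwise) order and, at each visit of $v_i$, surveying the subgons incident to $v_i$ in counterclockwise order around $v_i$; for each subgon $Q$ encountered, append $U$ if this is the first time $Q$ is encountered, append $R$ if it is neither the first nor the $(m+2)$-th time, and append nothing if it is the $(m+2)$-th time. (This is an $m$-Dyck path of order $\ell$.) The map $\widetilde{\mathsf{rot}}$ on an $m$-Dyck path $D=w_1\cdots w_r$: let $k+1$ be the position of the first $R$ (so $D$ begins $U^kR$); let $H_D(j)=\sum_{t\le j}h(w_t)$ with $h(U)=m$, $h(R)=-1$;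 for each $1\le i\le k-1$ let $p'_i>k$ be the smallest integer with $H_D(p'_i)<mi$, and simultaneously insert a letter $U$ immediately after the $p'_i$-th letter for each such $i$; then delete the initial $U^kR$; finally prepend a $U$ and append an $R$. The result is $\widetilde{\mathsf{rot}}(D)$. -}

module Defs where

open import Data.Bool.Properties using () renaming (_≟_ to _≟ᵇ_)
open import Data.Fin using (Fin; zero; suc; toℕ; fromℕ; inject₁; _<_)
open import Data.Fin.Properties using (all?; toℕ-inject₁; toℕ-fromℕ; toℕ<n)
  renaming (_≟_ to _≟ᶠ_; _<?_ to _<ᶠ?_)
open import Data.Fin.Relation.Unary.Top
  using (view; ‵fromℕ; ‵inject₁; view-fromℕ; view-inject₁)
open import Data.Fin.Subset using (Subset; inside; outside; _∈_; ∣_∣)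
open import Data.Fin.Subset.Properties using (_∈?_)
open import Data.Integer using (ℤ; +_; 0ℤ; -1ℤ)
import Data.Integer as ℤ
open import Data.List using (List; []; _∷_; [_]; _++_; _∷ʳ_; map; concatMap; filter; find;
  length; take; drop; takeWhile; iterate; replicate; allFin; upTo; mapMaybe; foldr)
open import Data.Maybe using (Maybe)
open import Data.Nat using (ℕ; zero; suc; _+_; _*_; _∸_; _≤_; s≤s; z≤n; _≤?_; _≟_)
import Data.Nat as ℕ
open import Data.Nat.Properties using (<⇒≱; ≤-pred)
open import Data.Product using (_×_; _,_; proj₁; proj₂)
open import Data.Sum using (_⊎_; inj₁; inj₂)
import Data.Sum as Sum
open import Data.Vec using ([]; _∷_; lookup; tabulate)
open import Data.Vec.Properties
  using (≡-dec; lookup∘tabulate; lookup⇒[]=; []=⇒lookup)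
open import Function using (_∘_)
open import Level using (0ℓ)
open import Relation.Binary using (Rel; Decidable; DecidableEquality; Symmetric)
open import Relation.Binary.PropositionalEquality
  using (_≡_; _≢_; refl; sym; trans; cong; subst; subst₂)
open import Relation.Nullary using (¬_; Dec; yes; no; ¬?; contradiction)
open import Relation.Nullary.Decidable using (map′; _×-dec_; _⊎-dec_; _→-dec_)

private
  variable
    m n N : ℕ

-- The polygon P_N: its vertices v₀, …, v_{N-1}, in clockwise order, are the
-- elements of Fin N.

next : Fin n → Fin n
next {suc n} i with view i
... | ‵fromℕ     = zero
... | ‵inject₁ j = suc j

prev : Fin n → Fin n
prev {suc n} zero    = fromℕ n
prev {suc n} (suc i) = inject₁ i

-- a, b, c are distinct and are met in this order going clockwise from a.
Clockwise : Fin N → Fin N → Fin N → Set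
Clockwise a b c = (a < b × b < c) ⊎ (b < c × c < a) ⊎ (c < a × a < b)

Side : Rel (Fin N) 0ℓ
Side a b = b ≡ next a ⊎ a ≡ next b

Crossing : Fin N → Fin N → Fin N → Fin N → Set
Crossing a b c d = Clockwise a c b × Clockwise b d a

-- b is the next element of Q after a in clockwise order.
Consecutive : Subset N → Rel (Fin N) 0ℓ
Consecutive Q a b =
  a ∈ Q × b ∈ Q × a ≢ b × (∀ x → x ∈ Q → ¬ Clockwise a x b)

-- The subgons cut out by a non-crossing set D of diagonals, each given
-- by its set of vertices Q: the sides of the convex polygon spanned by Q
-- are sides of P_N or diagonals of D, and no diagonal of D cuts through
-- its interior.
record IsSubgon (D : Rel (Fin N) 0ℓ) (Q : Subset N) : Set where
  constructor mkIsSubgon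
  field
    nondegenerate : 3 ≤ ∣ Q ∣
    bounded : ∀ a b → Consecutive Q a b → Side a b ⊎ D a b
    uncut   : ∀ a b → a ∈ Q → b ∈ Q → D a b →
              Consecutive Q a b ⊎ Consecutive Q b a

-- A set of diagonals is a symmetric decidable relation on the vertices.
record Angulation (m N : ℕ) : Set₁ where
  field
    Diag        : Rel (Fin N) 0ℓ
    diag?       : Decidable Diag
    diag-sym    : Symmetric Diag
    diagonal    : ∀ {a b} → Diag a b → a ≢ b × ¬ Side a b
    noncrossing : ∀ {a b c d} → Diag a b → Diag c d → ¬ Crossing a b c d
    subgon-size : ∀ Q → IsSubgon Diag Q → ∣ Q ∣ ≡ m + 2

next-fromℕ : ∀ n → next (fromℕ n) ≡ zero
next-fromℕ n rewrite view-fromℕ n = refl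

next-inject₁ : (i : Fin n) → next (inject₁ i) ≡ suc i
next-inject₁ i rewrite view-inject₁ i = refl

next-prev : (i : Fin n) → next (prev i) ≡ i
next-prev {suc n} zero    = next-fromℕ n
next-prev {suc n} (suc i) = next-inject₁ i

prev-next : (i : Fin n) → prev (next i) ≡ i
prev-next {suc n} i with view i
... | ‵fromℕ     = refl
... | ‵inject₁ j = refl

inject₁<fromℕ : (i : Fin n) → inject₁ i < fromℕ n
inject₁<fromℕ {n} i =
  subst₂ ℕ._<_ (sym (toℕ-inject₁ i)) (sym (toℕ-fromℕ n)) (toℕ<n i)

fromℕ≮ : (i : Fin (suc n)) → ¬ (fromℕ n < i)
fromℕ≮ {n} i p = <⇒≱ p
  (subst (toℕ i ≤_) (sym (toℕ-fromℕ n)) (≤-pred (toℕ<n i)))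

inject₁-< : {i j : Fin n} → i < j → inject₁ i < inject₁ j
inject₁-< {i = i} {j} = subst₂ ℕ._<_ (sym (toℕ-inject₁ i)) (sym (toℕ-inject₁ j))

inject₁-<⁻ : {i j : Fin n} → inject₁ i < inject₁ j → i < j
inject₁-<⁻ {i = i} {j} = subst₂ ℕ._<_ (toℕ-inject₁ i) (toℕ-inject₁ j)

turn : {a b c : Fin n} → Clockwise a b c → Clockwise b c a
turn (inj₁ p)        = inj₂ (inj₂ p)
turn (inj₂ (inj₁ p)) = inj₁ p
turn (inj₂ (inj₂ p)) = inj₂ (inj₁ p)

next-< : (a b c : Fin n) → a < b → b < c → Clockwise (next a) (next b) (next c)
next-< {suc n} a b c p q with view a | view b | view c
... | ‵fromℕ     | _          | _          = contradiction p (fromℕ≮ b)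
... | ‵inject₁ _ | ‵fromℕ     | _          = contradiction q (fromℕ≮ c)
... | ‵inject₁ _ | ‵inject₁ _ | ‵fromℕ     = inj₂ (inj₂ (s≤s z≤n , s≤s (inject₁-<⁻ p)))
... | ‵inject₁ _ | ‵inject₁ _ | ‵inject₁ _ = inj₁ (s≤s (inject₁-<⁻ p) , s≤s (inject₁-<⁻ q))

prev-< : (a b c : Fin n) → a < b → b < c → Clockwise (prev a) (prev b) (prev c)
prev-< zero    (suc b) (suc c) p (s≤s q) = inj₂ (inj₁ (inject₁-< q , inject₁<fromℕ c))
prev-< (suc a) (suc b) (suc c) (s≤s p) (s≤s q) = inj₁ (inject₁-< p , inject₁-< q)

module _ (f : Fin n → Fin n)
         (f-< : ∀ a b c → a < b → b < c → Clockwise (f a) (f b) (f c)) where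

  clockwise-map : ∀ {a b c} → Clockwise a b c → Clockwise (f a) (f b) (f c)
  clockwise-map (inj₁ (p , q))        = f-< _ _ _ p q
  clockwise-map (inj₂ (inj₁ (p , q))) = turn (turn (f-< _ _ _ p q))
  clockwise-map (inj₂ (inj₂ (p , q))) = turn (f-< _ _ _ p q)

clockwise-next : {a b c : Fin n} → Clockwise a b c → Clockwise (next a) (next b) (next c)
clockwise-next = clockwise-map next next-<

clockwise-prev : {a b c : Fin n} → Clockwise a b c → Clockwise (prev a) (prev b) (prev c)
clockwise-prev = clockwise-map prev prev-<

turnBack : Subset n → Subset n
turnBack Q = tabulate (lookup Q ∘ prev)

∣swap∣ : ∀ s t (Q : Subset n) → ∣ s ∷ t ∷ Q ∣ ≡ ∣ t ∷ s ∷ Q ∣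
∣swap∣ inside  inside  Q = refl
∣swap∣ inside  outside Q = refl
∣swap∣ outside inside  Q = refl
∣swap∣ outside outside Q = refl

∣∷∣ : ∀ s (P Q : Subset n) → ∣ P ∣ ≡ ∣ Q ∣ → ∣ s ∷ P ∣ ≡ ∣ s ∷ Q ∣
∣∷∣ inside  P Q = cong suc
∣∷∣ outside P Q = λ eq → eq

∣turnBack∣ : (Q : Subset n) → ∣ turnBack Q ∣ ≡ ∣ Q ∣
∣turnBack∣ []          = refl
∣turnBack∣ (s ∷ [])    = refl
∣turnBack∣ (s ∷ t ∷ Q) =
  trans (∣swap∣ (lookup (t ∷ Q) (fromℕ _)) s (tabulate (lookup (t ∷ Q) ∘ inject₁)))
        (∣∷∣ s (turnBack (t ∷ Q)) (t ∷ Q) (∣turnBack∣ (t ∷ Q)))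

∈-turnBack⁻ : ∀ {x} {Q : Subset n} → x ∈ turnBack Q → prev x ∈ Q
∈-turnBack⁻ {x = x} {Q} p =
  lookup⇒[]= (prev x) Q (trans (sym (lookup∘tabulate _ x)) ([]=⇒lookup p))

∈-turnBack⁺ : ∀ {x} {Q : Subset n} → prev x ∈ Q → x ∈ turnBack Q
∈-turnBack⁺ {x = x} {Q} p =
  lookup⇒[]= x _ (trans (lookup∘tabulate _ x) ([]=⇒lookup p))

next-∈-turnBack : ∀ {x} {Q : Subset n} → x ∈ Q → next x ∈ turnBack Q
next-∈-turnBack {x = x} {Q} p = ∈-turnBack⁺ (subst (_∈ Q) (sym (prev-next x)) p)

prev-injective : {a b : Fin n} → prev a ≡ prev b → a ≡ b
prev-injective {a = a} {b} eq = trans (sym (next-prev a)) (trans (cong next eq) (next-prev b))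

consecutive-prev : ∀ {a b} {Q : Subset n} →
                   Consecutive (turnBack Q) a b → Consecutive Q (prev a) (prev b)
consecutive-prev {a = a} {b} (a∈ , b∈ , a≢b , gap) =
  ∈-turnBack⁻ a∈ , ∈-turnBack⁻ b∈ , a≢b ∘ prev-injective , λ x x∈ cw →
    gap (next x) (next-∈-turnBack x∈)
      (subst₂ (λ u v → Clockwise u (next x) v) (next-prev a) (next-prev b)
        (clockwise-next cw))

consecutive-next : ∀ {a b} {Q : Subset n} →
                   Consecutive Q (prev a) (prev b) → Consecutive (turnBack Q) a b
consecutive-next (a∈ , b∈ , a≢b , gap) =
  ∈-turnBack⁺ a∈ , ∈-turnBack⁺ b∈ , a≢b ∘ cong prev , λ x x∈ cw →
    gap (prev x) (∈-turnBack⁻ x∈) (clockwise-prev cw)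

side-next : {a b : Fin n} → Side a b → Side (next a) (next b)
side-next = Sum.map (cong next) (cong next)

rotated : Rel (Fin N) 0ℓ → Rel (Fin N) 0ℓ
rotated D a b = D (next a) (next b)

rotated-prev : ∀ (D : Rel (Fin N) 0ℓ) {a b} → rotated D (prev a) (prev b) → D a b
rotated-prev D {a} {b} = subst₂ D (next-prev a) (next-prev b)

rotated-prev⁻ : ∀ (D : Rel (Fin N) 0ℓ) {a b} → D a b → rotated D (prev a) (prev b)
rotated-prev⁻ D {a} {b} = subst₂ D (sym (next-prev a)) (sym (next-prev b))

turnBack-subgon : {D : Rel (Fin N) 0ℓ} {Q : Subset N} →
                  IsSubgon (rotated D) Q → IsSubgon D (turnBack Q)
turnBack-subgon {D = D} {Q} (mkIsSubgon nd bd uc) = mkIsSubgon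
  (subst (3 ≤_) (sym (∣turnBack∣ Q)) nd)
  (λ a b con → Sum.map
    (λ s → subst₂ Side (next-prev a) (next-prev b) (side-next s))
    (rotated-prev D)
    (bd (prev a) (prev b) (consecutive-prev con)))
  (λ a b a∈ b∈ d → Sum.map consecutive-next consecutive-next
    (uc (prev a) (prev b) (∈-turnBack⁻ a∈) (∈-turnBack⁻ b∈) (rotated-prev⁻ D d)))

-- σ sends v_i to v_{i-1}: the pair (v_a , v_b) belongs to σ T exactly
-- when (v_{a+1} , v_{b+1}) belongs to T.
σ : Angulation m N → Angulation m N
σ T = record
  { Diag        = λ a b → Diag (next a) (next b)
  ; diag?       = λ a b → diag? (next a) (next b)
  ; diag-sym    = diag-sym
  ; diagonal    = λ d → proj₁ (diagonal d) ∘ cong next , proj₂ (diagonal d) ∘ side-next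
  ; noncrossing = λ d e (p , q) → noncrossing d e (clockwise-next p , clockwise-next q)
  ; subgon-size = λ Q sub → trans (sym (∣turnBack∣ Q)) (subgon-size (turnBack Q) (turnBack-subgon sub))
  }
  where open Angulation T

data Step : Set where
  U R : Step

Word : Set
Word = List Step

_≟ˢ_ : DecidableEquality Step
U ≟ˢ U = yes refl
U ≟ˢ R = no λ ()
R ≟ˢ U = no λ ()
R ≟ˢ R = yes refl

#U #R : Word → ℕ
#U w = length (filter (_≟ˢ U) w)
#R w = length (filter (_≟ˢ R) w)

-- After the first j steps the path is at the lattice point
-- (#R (take j w) , #U (take j w)).
record IsDyckPath (m ℓ : ℕ) (w : Word) : Set where
  field
    right-steps  : #R w ≡ m * ℓ
    up-steps     : #U w ≡ ℓ
    weakly-above : ∀ j → #R (take j w) ≤ m * #U (take j w)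

clockwise? : (a b c : Fin N) → Dec (Clockwise a b c)
clockwise? a b c =
  ((a <ᶠ? b) ×-dec (b <ᶠ? c)) ⊎-dec ((b <ᶠ? c) ×-dec (c <ᶠ? a)) ⊎-dec ((c <ᶠ? a) ×-dec (a <ᶠ? b))

side? : Decidable (Side {N})
side? a b = (b ≟ᶠ next a) ⊎-dec (a ≟ᶠ next b)

consecutive? : (Q : Subset N) → Decidable (Consecutive Q)
consecutive? Q a b =
  (a ∈? Q) ×-dec (b ∈? Q) ×-dec ¬? (a ≟ᶠ b) ×-dec
  all? (λ x → (x ∈? Q) →-dec ¬? (clockwise? a x b))

isSubgon? : {D : Rel (Fin N) 0ℓ} → Decidable D → (Q : Subset N) → Dec (IsSubgon D Q)
isSubgon? D? Q = map′
  (λ (nd , bd , uc) → mkIsSubgon nd bd uc)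
  (λ (mkIsSubgon nd bd uc) → nd , bd , uc)
  ((3 ≤? ∣ Q ∣) ×-dec
   all? (λ a → all? λ b → consecutive? Q a b →-dec (side? a b ⊎-dec D? a b)) ×-dec
   all? (λ a → all? λ b → (a ∈? Q) →-dec (b ∈? Q) →-dec D? a b →-dec
                          (consecutive? Q a b ⊎-dec consecutive? Q b a)))

_≟ˢᵘᵇ_ : DecidableEquality (Subset N)
_≟ˢᵘᵇ_ = ≡-dec _≟ᵇ_

subsets : ∀ N → List (Subset N)
subsets zero    = [ [] ]
subsets (suc N) = map (outside ∷_) (subsets N) ++ map (inside ∷_) (subsets N)

-- The letter appended when a subgon already encountered c times is
-- encountered once more.
letter : (m c : ℕ) → Word
letter m zero = [ U ]
letter m c@(suc _) with suc c ≟ m + 2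
... | yes _ = []
... | no  _ = [ R ]

transcribe : (m : ℕ) (seen upcoming : List (Subset N)) → Word
transcribe m seen []       = []
transcribe m seen (Q ∷ Qs) =
  letter m (length (filter (Q ≟ˢᵘᵇ_) seen)) ++ transcribe m (Q ∷ seen) Qs

module _ {m N : ℕ} (T : Angulation m N) where
  open Angulation T

  subgons : List (Subset N)
  subgons = filter (isSubgon? diag?) (subsets N)

  -- As the polygon is labelled clockwise, a ray turning counterclockwise
  -- around v_i sweeps the interior from v_{i-1} through v_{i-2}, … to
  -- v_{i+1}.  It enters an incident subgon Q at the vertex of Q that
  -- precedes v_i clockwise.
  survey : Fin N → List (Subset N)
  survey i = concatMap (λ a → filter (λ Q → consecutive? Q a i) subgons)
                       (iterate prev (prev i) (N ∸ 1))

  brow : Word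
  brow = transcribe m [] (concatMap survey (allFin N))

-- Positions in words are numbered from 1.
module _ (m : ℕ) where

  h : Step → ℤ
  h U = + m
  h R = -1ℤ

  H : Word → ℕ → ℤ
  H D j = foldr ℤ._+_ 0ℤ (map h (take j D))

  initialUs : Word → ℕ
  initialUs D = length (takeWhile (_≟ˢ U) D)

  -- The candidates for p′ᵢ are k + 1, …, length D.  On an m-Dyck path the
  -- search succeeds for every 1 ≤ i ≤ k - 1, since H ends at 0.
  p′ : Word → ℕ → Maybe ℕ
  p′ D i = find (λ p → H D p ℤ.<? + (m * i))
                (drop (suc (initialUs D)) (upTo (suc (length D))))

  insertionPoints : Word → List ℕ
  insertionPoints D = mapMaybe (p′ D) (drop 1 (upTo (initialUs D)))

  -- The second argument is the position of the first letter of the word.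
  insertUs : (ps : List ℕ) → ℕ → Word → Word
  insertUs ps p []      = []
  insertUs ps p (x ∷ w) =
    x ∷ replicate (length (filter (p ≟_) ps)) U ++ insertUs ps (suc p) w

  -- All insertions take place after the initial Uᵏ R, so that deleting
  -- the first k + 1 letters deletes exactly this factor.
  rot : Word → Word
  rot D = U ∷ drop (suc (initialUs D)) (insertUs (insertionPoints D) 1 D) ∷ʳ R

{-# OPTIONS --safe #-}
module Submission where

-- Cutting P_N along the diagonals of T gives a tree: the edge (v_0 , v_{N-1}) is its root,
-- and the subgon below an edge has as children the m + 1 edges on its other sides.  The
-- browse visits the subgons in the order V, where V = Q V₁ Q V₂ … V_{m+1} Q for a subgon Q
-- with subtrees t₁, …, t_{m+1}, and so brow T is the word W = U W₁ R W₂ … R W_{m+1} of the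
-- tree.  The survey at v_0 meets the subgons Q₁, …, Q_k on the left spine of the tree.
-- After the rotation these visits come last instead of first, where they contribute no
-- letter, and the first visit of Q_j has moved to its second vertex.  This turns the word
-- Uᵏ (R B_k) … (R B_1) into (U B_k R) … (U B_1 R), which is the effect of rot as well.

open import Defs
open import Data.Fin using (Fin; zero; suc; toℕ; fromℕ)
import Data.Fin as Fin
open import Data.Fin.Induction using (<-wellFounded; >-wellFounded; spo-wellFounded; spo-noetherian)
open import Data.Fin.Properties
  using (any?; toℕ<n; toℕ-inject₁; toℕ-fromℕ; toℕ-injective)
  renaming (_≟_ to _≟ᶠ_; _<?_ to _<ᶠ?_)
import Data.Fin.Properties as Fin
open import Data.Fin.Relation.Unary.Top using (view; ‵fromℕ; ‵inject₁)
open import Data.Fin.Subset using (Subset; inside; outside; _∈_; _∉_; ∣_∣; _⊆_)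
open import Data.Fin.Subset.Properties
  using (_∈?_; p⊂q⇒∣p∣<∣q∣; Empty-unique; ∣⊥∣≡0; ⊆-antisym)
open import Data.Integer using (-1ℤ) renaming (+_ to pos)
import Data.Integer as ℤ
import Data.Integer.Properties as ℤ
open import Data.List using (List; []; _∷_; [_]; _++_; _∷ʳ_; _ʳ++_; concatMap; drop; filter;
  find; foldr; iterate; length; map; mapMaybe; replicate; tabulate; take; upTo; applyUpTo)
import Data.List.Membership.Propositional as List
open import Data.List.Membership.Propositional.Properties
  using (∈-filter⁺; ∈-filter⁻; ∈-map⁺; ∈-map⁻; ∈-++⁺ˡ; ∈-++⁺ʳ; ∈-++⁻)
open import Data.List.Properties using (length-++; length-replicate; ++-assoc; ++-identityʳ;
  ++-cancelˡ; filter-++; filter-accept; filter-reject; filter-none; map-++; concatMap-++;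
  mapMaybe-++; upTo-∷ʳ)
open import Data.List.Relation.Unary.All using (All; []; _∷_)
import Data.List.Relation.Unary.All as All
import Data.List.Relation.Unary.All.Properties as All
open import Data.List.Relation.Unary.AllPairs using ([]; _∷_)
open import Data.List.Relation.Unary.Any using (here; there)
open import Data.List.Relation.Unary.Unique.Propositional using (Unique)
import Data.List.Relation.Unary.Unique.Propositional.Properties as Unique
open import Data.Maybe using (just)
open import Data.Nat using (ℕ; zero; suc; _+_; _*_; _≤_; _<_; z≤n; s≤s)
open import Data.Nat.Properties
open import Data.Product using (_×_; _,_; proj₁; proj₂; Σ-syntax; ∃-syntax)
open import Data.Sum using (_⊎_; inj₁; inj₂; swap)
import Data.Sum as Sum
open import Data.Vec using ([]; _∷_; here; there; lookup; _[_]≔_)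
import Data.Vec as Vec
import Data.Vec.Properties as Vec
open import Function using (_∘_; id; flip)
open import Induction.WellFounded using (WellFounded; Acc; acc)
open import Level using (0ℓ)
import Relation.Binary as Binary
open import Relation.Binary using (Rel; Symmetric; IsStrictPartialOrder; tri<; tri≈; tri>)
open import Relation.Binary.PropositionalEquality
  using (_≡_; _≢_; refl; sym; ≢-sym; trans; cong; cong₂; subst; subst₂; isEquivalence;
         module ≡-Reasoning)
open import Relation.Nullary using (¬_; Dec; yes; no; ¬?; contradiction; does)
open import Relation.Nullary.Decidable using (_×-dec_; dec-true; dec-false)
open import Relation.Unary using (Pred; Decidable)

-- The sweep of `σ T` is the sweep of `T` begun at v_1, up to an injective renaming of the subgons,
-- which affects no letter. A spine subgon Q_j is met m + 2 times. Begun at v_0, the sweep gives U,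
-- then m times R, then nothing. Begun at v_1, the visit at v_0 comes last and is silent, the first
-- R becomes U, and the formerly silent visit gives R: so R B_j turns into U B_j R. On the side of
-- `rot`, the height after U^k is mk and each R B_j descends by exactly m, so the first step below
-- mi is the R in front of B_i. Inserting U after these R for i < k and deleting U^k R leaves B_k (R
-- U B_{k-1}) ... (R U B_1); the outer U and R regroup this as (U B_k R) ... (U B_1 R). Two facts of
-- geometry make the counting of encounters sound: a subgon is determined by one of its directed
-- sides, so each position of the sweep meets at most one subgon, and distinct nodes of the tree
-- carry distinct subgons.

-- Heights along lattice paths.

-- Climb m a w b: from height a the path w never goes below height 0 and ends at
-- height b, where U climbs m and R descends 1.
data Climb (m : ℕ) : ℕ → Word → ℕ → Set where
  []   : ∀ {a} → Climb m a [] a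
  up   : ∀ {a b w} → Climb m (m + a) w b → Climb m a (U ∷ w) b
  down : ∀ {a b w} → Climb m a w b → Climb m (suc a) (R ∷ w) b

climb-++ : ∀ {m a b c v w} → Climb m a v b → Climb m b w c → Climb m a (v ++ w) c
climb-++ []       q = q
climb-++ (up p)   q = up (climb-++ p q)
climb-++ (down p) q = down (climb-++ p q)

climb-lift : ∀ {m a b w} d → Climb m a w b → Climb m (a + d) w (b + d)
climb-lift d [] = []
climb-lift {m} {a} {b} d (up {w = w} p) = up (subst (λ x → Climb m x w (b + d)) (+-assoc m a d) (climb-lift d p))
climb-lift d (down p) = down (climb-lift d p)

climb-take : ∀ {m a w b} j → Climb m a w b → ∃[ c ] Climb m a (take j w) c
climb-take zero    p        = _ , []
climb-take (suc j) []       = _ , []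
climb-take (suc j) (up p)   = let c , q = climb-take j p in c , up q
climb-take (suc j) (down p) = let c , q = climb-take j p in c , down q

climb-Us : ∀ m k {a} → Climb m a (replicate k U) (m * k + a)
climb-Us m zero {a} = subst (Climb m a []) (cong (_+ a) (sym (*-zeroʳ m))) []
climb-Us m (suc k) {a} = up (subst (Climb m (m + a) _) eq (climb-Us m k))
  where
  open ≡-Reasoning
  eq : m * k + (m + a) ≡ m * suc k + a
  eq = begin
    m * k + (m + a)  ≡⟨ +-assoc (m * k) m a ⟨
    m * k + m + a    ≡⟨ cong (_+ a) (+-comm (m * k) m) ⟩
    m + m * k + a    ≡⟨ cong (_+ a) (*-suc m k) ⟨
    m * suc k + a    ∎

climb-above : ∀ {m a w b} → Climb m a w b → ∀ j → #R (take j w) ≤ a + m * #U (take j w)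
climb-above p zero = z≤n
climb-above [] (suc j) = z≤n
climb-above {m} {a} (up {w = w} p) (suc j) = begin
  #R (take j w)                        ≤⟨ climb-above p j ⟩
  m + a + m * #U (take j w)            ≡⟨ cong (_+ m * #U (take j w)) (+-comm m a) ⟩
  a + m + m * #U (take j w)            ≡⟨ +-assoc a m _ ⟩
  a + (m + m * #U (take j w))          ≡⟨ cong (a +_) (*-suc m (#U (take j w))) ⟨
  a + m * suc (#U (take j w))          ∎
  where open ≤-Reasoning
climb-above (down p) (suc j) = s≤s (climb-above p j)

total : (m : ℕ) → Word → ℤ.ℤ
total m w = foldr ℤ._+_ (pos 0) (map (h m) w)

climb-total : ∀ {m a w b} → Climb m a w b → pos a ℤ.+ total m w ≡ pos b
climb-total {a = a} [] = cong pos (+-identityʳ a)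
climb-total {m} {a} (up {w = w} p) = begin
  pos a ℤ.+ (pos m ℤ.+ total m w)  ≡⟨ ℤ.+-assoc (pos a) (pos m) (total m w) ⟨
  pos (a + m) ℤ.+ total m w        ≡⟨ cong (λ x → pos x ℤ.+ total m w) (+-comm a m) ⟩
  pos (m + a) ℤ.+ total m w        ≡⟨ climb-total p ⟩
  _                                ∎
  where open ≡-Reasoning
climb-total {m} (down {a} {w = w} p) =
  trans (sym (ℤ.+-assoc (pos (suc a)) -1ℤ (total m w))) (climb-total p)

climb-total₀ : ∀ {m b w} → Climb m 0 w b → total m w ≡ pos b
climb-total₀ p = trans (sym (ℤ.+-identityˡ _)) (climb-total p)

-- The map `rot` on words cut into blocks.

module _ {A : Set} {P : Pred A 0ℓ} (P? : Decidable P) where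

  find-applyUpTo : ∀ f {n} i → i < n → P (f i) → (∀ j → j < i → ¬ P (f j)) →
                   find P? (applyUpTo f n) ≡ just (f i)
  find-applyUpTo f zero (s≤s i<n) pi np rewrite dec-true (P? (f 0)) pi = refl
  find-applyUpTo f (suc i) (s≤s i<n) pi np rewrite dec-false (P? (f 0)) (np 0 (s≤s z≤n)) =
    find-applyUpTo (f ∘ suc) i i<n pi (λ j j<i → np (suc j) (s≤s j<i))

drop-applyUpTo : ∀ {A : Set} (f : ℕ → A) s n →
                 drop s (applyUpTo f (s + n)) ≡ applyUpTo (λ i → f (s + i)) n
drop-applyUpTo f zero    n = refl
drop-applyUpTo f (suc s) n = drop-applyUpTo (f ∘ suc) s n

module _ {A : Set} where

  take-length-+ : ∀ (xs : List A) {ys} j → take (length xs + j) (xs ++ ys) ≡ xs ++ take j ys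
  take-length-+ []       j = refl
  take-length-+ (x ∷ xs) j = cong (x ∷_) (take-length-+ xs j)

  ʳ++-assoc : ∀ (xs : List A) {ys zs} → (xs ʳ++ ys) ++ zs ≡ xs ʳ++ (ys ++ zs)
  ʳ++-assoc []       = refl
  ʳ++-assoc (x ∷ xs) = ʳ++-assoc xs

  take-≤ : ∀ (xs : List A) {ys} {j} → j ≤ length xs → take j (xs ++ ys) ≡ take j xs
  take-≤ []       z≤n     = refl
  take-≤ (x ∷ xs) z≤n     = refl
  take-≤ (x ∷ xs) (s≤s p) = cong (x ∷_) (take-≤ xs p)

initialUs-Us : ∀ k w → initialUs 0 (replicate k U ++ R ∷ w) ≡ k
initialUs-Us zero    w = refl
initialUs-Us (suc k) w = cong suc (initialUs-Us k w)

count : ℕ → List ℕ → ℕ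
count p ps = length (filter (p ≟_) ps)

count-none : ∀ {p ps} → All (p ≢_) ps → count p ps ≡ 0
count-none {p} none = cong length (filter-none (p ≟_) none)

count-ʳ++ : ∀ p {xs} ys → All (p ≢_) xs → count p (xs ʳ++ ys) ≡ count p ys
count-ʳ++ p ys []              = refl
count-ʳ++ p {x ∷ xs} ys (n ∷ ns) =
  trans (count-ʳ++ p (x ∷ ys) ns) (cong length (filter-reject (p ≟_) n))

module _ (m : ℕ) where

  -- A letter U goes behind the letter at its position, so only the positions from p to p + length v
  -- - 1 could break up v.
  insertUs-++ : ∀ ps p v {w} → All (λ q → q < p ⊎ p + length v ≤ q) ps →
                insertUs m ps p (v ++ w) ≡ v ++ insertUs m ps (p + length v) w
  insertUs-++ ps p [] {w} out = cong (λ x → insertUs m ps x w) (sym (+-identityʳ p))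
  insertUs-++ ps p (x ∷ v) {w} out = cong (x ∷_) (begin
      replicate (count p ps) U ++ insertUs m ps (suc p) (v ++ w)
    ≡⟨ cong₂ (λ y z → replicate y U ++ z) (count-none (All.map away out))
         (insertUs-++ ps (suc p) v (All.map later out)) ⟩
      v ++ insertUs m ps (suc p + length v) w
    ≡⟨ cong (λ y → v ++ insertUs m ps y w) (+-suc p (length v)) ⟨
      v ++ insertUs m ps (p + suc (length v)) w
    ∎)
    where
    open ≡-Reasoning
    away : ∀ {q} → q < p ⊎ p + suc (length v) ≤ q → p ≢ q
    away (inj₁ lt) refl = <-irrefl refl lt
    away (inj₂ le) refl = <-irrefl refl (≤-trans (m<m+n p (s≤s z≤n)) le)
    later : ∀ {q} → q < p ⊎ p + suc (length v) ≤ q → q < suc p ⊎ suc p + length v ≤ q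
    later (inj₁ lt) = inj₁ (m<n⇒m<1+n lt)
    later {q} (inj₂ le) = inj₂ (subst (_≤ q) (+-suc p (length v)) le)

-- The positions of the letters R in front of the blocks, when the first has position p.
positions : ℕ → List Word → List ℕ
positions p []       = []
positions p (B ∷ Bs) = p ∷ positions (suc p + length B) Bs

positions-≥ : ∀ p Bs → All (p ≤_) (positions p Bs)
positions-≥ p []       = []
positions-≥ p (B ∷ Bs) =
  ≤-refl ∷ All.map (≤-trans (≤-trans (n≤1+n p) (m≤m+n (suc p) _))) (positions-≥ _ Bs)

All-ʳ++ : ∀ {A : Set} {P : A → Set} {xs ys} → All P xs → All P ys → All P (xs ʳ++ ys)
All-ʳ++ []       qs = qs
All-ʳ++ (p ∷ ps) qs = All-ʳ++ ps (p ∷ qs)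

-- `qs` holds the insertion points already passed. Reversing onto an accumulator keeps the list of
-- points in the same shape from one block to the next.
insertUs-blocks : ∀ m p Bs qs → All (_< p) qs →
  insertUs m (positions p Bs ʳ++ qs) p (concatMap (R ∷_) Bs) ≡
  concatMap (λ B → R ∷ U ∷ B) Bs
insertUs-blocks m p []       qs qs<p = refl
insertUs-blocks m p (B ∷ Bs) qs qs<p = cong (R ∷_) (begin
    replicate (count p ps) U ++ insertUs m ps (suc p) (B ++ concatMap (R ∷_) Bs)
  ≡⟨ cong₂ (λ x y → replicate x U ++ y) once (insertUs-++ m ps (suc p) B elsewhere) ⟩
    U ∷ B ++ insertUs m ps (suc p + length B) (concatMap (R ∷_) Bs)
  ≡⟨ cong (λ x → U ∷ B ++ x) (insertUs-blocks m (suc p + length B) Bs (p ∷ qs)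
       (≤-trans (n<1+n p) (m≤m+n _ _) ∷ All.map (λ lt → ≤-trans lt (≤-trans (n≤1+n p) (m≤m+n _ _))) qs<p)) ⟩
    U ∷ B ++ concatMap (λ B′ → R ∷ U ∷ B′) Bs
  ∎)
  where
  open ≡-Reasoning
  ps : List ℕ
  ps = positions (suc p + length B) Bs ʳ++ (p ∷ qs)
  later : All (suc p + length B ≤_) (positions (suc p + length B) Bs)
  later = positions-≥ _ Bs
  once : count p ps ≡ 1
  once = trans (count-ʳ++ p (p ∷ qs) (All.map (λ le → <⇒≢ (≤-trans (m≤m+n (suc p) _) le)) later))
    (trans (cong length (filter-accept (p ≟_) refl))
      (cong suc (count-none (All.map (λ lt → ≢-sym (<⇒≢ lt)) qs<p))))
  elsewhere : All (λ q → q < suc p ⊎ suc p + length B ≤ q) ps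
  elsewhere = All-ʳ++ (All.map inj₂ later) (inj₁ ≤-refl ∷ All.map (inj₁ ∘ m<n⇒m<1+n) qs<p)

module _ (k : ℕ) where

  private
    m′ = suc k

  -- As m is `suc k`, the word `R ∷ B` goes from relative height m to 0 and never below 0.
  Block : Word → Set
  Block B = Climb m′ k B 0

  module _ (K : ℕ) (D : Word) where

    -- The initial letters U end at height `m′ * K`, which is c above the level `m′ * suc n`. The
    -- word `mid` comes down to this level without passing it, so the R behind `mid` is the first
    -- step below.
    p′-spec : ∀ mid post n c → D ≡ replicate K U ++ mid ++ R ∷ post → 1 ≤ length mid →
              m′ * K ≡ c + m′ * suc n → Climb m′ c mid 0 →
              initialUs m′ D ≡ K → p′ m′ D (suc n) ≡ just (suc (K + length mid))
    p′-spec mid post n c refl 1≤ K≡ climb ini rewrite ini = begin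
        find low? (drop (suc K) (upTo (suc (length D))))
      ≡⟨ cong (λ x → find low? (drop (suc K) (upTo (suc x)))) len ⟩
        find low? (drop (suc K) (upTo (suc K + suc (length mid + length post))))
      ≡⟨ cong (find low?) (drop-applyUpTo id (suc K) (suc (length mid + length post))) ⟩
        find low? (applyUpTo (λ i → suc (K + i)) (suc (length mid + length post)))
      ≡⟨ find-applyUpTo low? (λ i → suc (K + i)) (length mid) (s≤s (m≤m+n _ _)) low high ⟩
        just (suc (K + length mid))
      ∎
      where
      open ≡-Reasoning
      low? : Decidable (λ p → H m′ D p ℤ.< pos (m′ * suc n))
      low? p = H m′ D p ℤ.<? pos (m′ * suc n)
      len : length D ≡ K + suc (length mid + length post)
      len = trans (length-++ (replicate K U))
        (cong₂ _+_ (length-replicate K) (trans (length-++ mid) (+-suc _ _)))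
      takeK : ∀ j → take (K + j) D ≡ replicate K U ++ take j (mid ++ R ∷ post)
      takeK j = trans (cong (λ x → take (x + j) D) (sym (length-replicate K)))
        (take-length-+ (replicate K U) j)
      climbUs : Climb m′ 0 (replicate K U) (c + m′ * suc n)
      climbUs = subst (Climb m′ 0 _) (trans (+-identityʳ _) K≡) (climb-Us m′ K)
      low : H m′ D (suc (K + length mid)) ℤ.< pos (m′ * suc n)
      low = subst (ℤ._< _) (sym (trans
          (cong (total m′) (trans (cong (λ x → take x D)
               (sym (trans (cong (K +_) (+-comm (length mid) 1)) (+-suc K _))))
             (trans (takeK (length mid + 1)) (cong (replicate K U ++_) (take-length-+ mid 1)))))
          (climb-total₀ (climb-++ climbUs (climb-++ (climb-lift (m′ * suc n) climb) (down []))))))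
        (ℤ.+<+ ≤-refl)
      high : ∀ j → j < length mid → ¬ H m′ D (suc (K + j)) ℤ.< pos (m′ * suc n)
      high j j< lt with climb-take (suc j) climb
      ... | d , cl = ℤ.<-irrefl refl (ℤ.<-≤-trans
          (subst (ℤ._< _) (trans (cong (total m′) (trans (cong (λ x → take x D) (sym (+-suc K j)))
              (trans (takeK (suc j)) (cong (replicate K U ++_) (take-≤ mid j<)))))
            (climb-total₀ (climb-++ climbUs (climb-lift (m′ * suc n) cl)))) lt)
          (ℤ.+≤+ (m≤n+m _ d)))

    -- The largest i belongs to the leftmost remaining block, so the points come out in reverse
    -- order. Each round absorbs `R ∷ B` into `mid`; the reference level sinks by m′, and c grows by
    -- m′.
    insertionPoints-spec : ∀ mid Bs c → All Block Bs →
      D ≡ replicate K U ++ mid ++ concatMap (R ∷_) Bs → 1 ≤ length mid →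
      m′ * K ≡ c + m′ * length Bs → Climb m′ c mid 0 → initialUs m′ D ≡ K →
      mapMaybe (p′ m′ D) (drop 1 (upTo (suc (length Bs)))) ≡
      positions (suc (K + length mid)) Bs ʳ++ []
    insertionPoints-spec mid [] c good D≡ 1≤ K≡ climb ini = refl
    insertionPoints-spec mid (B ∷ Bs) c (g ∷ good) D≡ 1≤ K≡ climb ini = begin
        mapMaybe f (drop 1 (upTo (suc (suc (length Bs)))))
      ≡⟨ cong (mapMaybe f ∘ drop 1) (upTo-∷ʳ (suc (length Bs))) ⟨
        mapMaybe f (drop 1 (upTo (suc (length Bs)) ∷ʳ suc (length Bs)))
      ≡⟨ mapMaybe-++ f (drop 1 (upTo (suc (length Bs)))) [ suc (length Bs) ] ⟩
        mapMaybe f (drop 1 (upTo (suc (length Bs)))) ++ mapMaybe f [ suc (length Bs) ]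
      ≡⟨ cong₂ _++_ rec last ⟩
        (positions (suc (K + length (mid ++ R ∷ B))) Bs ʳ++ []) ++ [ p ]
      ≡⟨ cong (λ x → (positions x Bs ʳ++ []) ++ [ p ]) (trans
           (cong (λ x → suc (K + x)) (length-++ mid))
           (cong suc (trans (sym (+-assoc K _ _)) (+-suc (K + length mid) _)))) ⟩
        (positions (suc p + length B) Bs ʳ++ []) ++ [ p ]
      ≡⟨ ʳ++-assoc (positions (suc p + length B) Bs) ⟩
        positions (suc p + length B) Bs ʳ++ [ p ]
      ∎
      where
      open ≡-Reasoning
      f = p′ m′ D
      p = suc (K + length mid)
      last : mapMaybe f [ suc (length Bs) ] ≡ [ p ]
      last rewrite p′-spec mid (B ++ concatMap (R ∷_) Bs) (length Bs) c D≡ 1≤ K≡ climb ini = refl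
      rec : mapMaybe f (drop 1 (upTo (suc (length Bs)))) ≡
            positions (suc (K + length (mid ++ R ∷ B))) Bs ʳ++ []
      rec = insertionPoints-spec (mid ++ R ∷ B) Bs (c + m′) good
        (trans D≡ (cong (replicate K U ++_) (sym (++-assoc mid (R ∷ B) _))))
        (≤-trans 1≤ (subst (length mid ≤_) (sym (length-++ mid)) (m≤m+n _ _)))
        (trans K≡ (trans (cong (c +_) (*-suc m′ (length Bs))) (sym (+-assoc c m′ _))))
        (climb-++ (climb-lift m′ climb) (down g))
        ini

  rot-blocks : ∀ B Bs → All Block (B ∷ Bs) →
    rot m′ (replicate (length (B ∷ Bs)) U ++ concatMap (R ∷_) (B ∷ Bs)) ≡
    concatMap (λ B′ → U ∷ B′ ∷ʳ R) (B ∷ Bs)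
  rot-blocks B Bs (g ∷ good) = begin
      U ∷ drop (suc (initialUs m′ D)) (insertUs m′ (insertionPoints m′ D) 1 D) ∷ʳ R
    ≡⟨ cong₂ (λ x y → U ∷ drop (suc x) (insertUs m′ y 1 D) ∷ʳ R) ini points ⟩
      U ∷ drop (suc K) (insertUs m′ ps 1 D) ∷ʳ R
    ≡⟨ cong (λ x → U ∷ drop (suc K) (insertUs m′ ps 1 x) ∷ʳ R) (sym (++-assoc (replicate K U) (R ∷ B) _)) ⟩
      U ∷ drop (suc K) (insertUs m′ ps 1 (pre ++ concatMap (R ∷_) Bs)) ∷ʳ R
    ≡⟨ cong (λ x → U ∷ drop (suc K) x ∷ʳ R) (insertUs-++ m′ ps 1 pre
         (All-ʳ++ (All.map inj₂ (subst (λ x → All (x ≤_) (positions p Bs)) len (positions-≥ p Bs))) [])) ⟩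
      U ∷ drop (suc K) (pre ++ insertUs m′ ps (1 + length pre) (concatMap (R ∷_) Bs)) ∷ʳ R
    ≡⟨ cong (λ x → U ∷ drop (suc K) (pre ++ insertUs m′ ps x (concatMap (R ∷_) Bs)) ∷ʳ R) (sym len) ⟩
      U ∷ drop (suc K) (pre ++ insertUs m′ ps p (concatMap (R ∷_) Bs)) ∷ʳ R
    ≡⟨ cong (λ x → U ∷ drop (suc K) (pre ++ x) ∷ʳ R) (insertUs-blocks m′ p Bs [] []) ⟩
      U ∷ drop (suc K) (pre ++ concatMap (λ B′ → R ∷ U ∷ B′) Bs) ∷ʳ R
    ≡⟨ cong (λ x → U ∷ x ∷ʳ R) (trans (cong (drop (suc K)) (++-assoc (replicate K U) (R ∷ B) _)) (dropUs K)) ⟩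
      U ∷ (B ++ concatMap (λ B′ → R ∷ U ∷ B′) Bs) ∷ʳ R
    ≡⟨ cong (U ∷_) (shift B Bs) ⟩
      U ∷ (B ∷ʳ R) ++ concatMap (λ B′ → U ∷ B′ ∷ʳ R) Bs
    ∎
    where
    open ≡-Reasoning
    K = length (B ∷ Bs)
    D = replicate K U ++ concatMap (R ∷_) (B ∷ Bs)
    p = suc (K + suc (length B))
    ps = positions p Bs ʳ++ []
    pre = replicate K U ++ R ∷ B
    len : p ≡ 1 + length pre
    len = cong suc (sym (trans (length-++ (replicate K U)) (cong (_+ suc (length B)) (length-replicate K))))
    ini : initialUs m′ D ≡ K
    ini = initialUs-Us K _
    points : insertionPoints m′ D ≡ ps
    points = trans (cong (λ x → mapMaybe (p′ m′ D) (drop 1 (upTo x))) ini)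
      -- As i stops at K - 1, no U goes behind the first R, and `R ∷ B` is the initial `mid`,
      -- descending from m′ to 0.
      (insertionPoints-spec K D (R ∷ B) Bs m′ good refl (s≤s z≤n) (*-suc m′ (length Bs)) (down g) ini)
    dropUs : ∀ j {w} → drop (suc j) (replicate j U ++ R ∷ w) ≡ w
    dropUs zero    = refl
    dropUs (suc j) = dropUs j
    -- The R that opens each later block is read as closing the block before it, and the appended R
    -- closes the last block.
    shift : ∀ B Bs → (B ++ concatMap (λ B′ → R ∷ U ∷ B′) Bs) ∷ʳ R ≡
                     (B ∷ʳ R) ++ concatMap (λ B′ → U ∷ B′ ∷ʳ R) Bs
    shift B [] = trans (cong (_∷ʳ R) (++-identityʳ B)) (sym (++-identityʳ (B ∷ʳ R)))
    shift B (C ∷ Cs) = begin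
        (B ++ R ∷ U ∷ C ++ concatMap (λ B′ → R ∷ U ∷ B′) Cs) ∷ʳ R
      ≡⟨ ++-assoc B _ [ R ] ⟩
        B ++ R ∷ U ∷ (C ++ concatMap (λ B′ → R ∷ U ∷ B′) Cs) ∷ʳ R
      ≡⟨ cong (λ x → B ++ R ∷ U ∷ x) (shift C Cs) ⟩
        B ++ R ∷ U ∷ (C ∷ʳ R) ++ concatMap (λ B′ → U ∷ B′ ∷ʳ R) Cs
      ≡⟨ ++-assoc B [ R ] _ ⟨
        (B ∷ʳ R) ++ U ∷ (C ∷ʳ R) ++ concatMap (λ B′ → U ∷ B′ ∷ʳ R) Cs
      ∎

-- Trees, their words and their blocks.

private
  variable
    m n M : ℕ
    a b c d x : Fin M
    Q Q′ : Subset M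

unique-++⁻ : ∀ {A : Set} (xs : List A) {ys} → Unique (xs ++ ys) →
             Unique xs × Unique ys × (∀ {x} → x List.∈ xs → x List.∉ ys)
unique-++⁻ [] u = [] , u , λ ()
unique-++⁻ (x ∷ xs) (x# ∷ u) with unique-++⁻ xs u | All.++⁻ xs x#
... | uxs , uys , dis | x#xs , x#ys =
  x#xs ∷ uxs , uys , λ { (here refl) x∈ → All.lookup x#ys x∈ refl ; (there p) → dis p }

mutual

  -- The first child stands apart because its word follows the U of the node directly, while each of
  -- the other m is preceded by an R.
  data Tree (m M : ℕ) : Set where
    leaf : Tree m M
    node : Subset M → Tree m M → Forest m M m → Tree m M

  data Forest (m M : ℕ) : ℕ → Set where
    []  : Forest m M 0
    _∷_ : ∀ {n} → Tree m M → Forest m M n → Forest m M (suc n)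

mutual

  word : Tree m M → Word
  word leaf          = []
  word (node Q t ts) = U ∷ word t ++ wordF ts

  wordF : Forest m M n → Word
  wordF []       = []
  wordF (t ∷ ts) = R ∷ word t ++ wordF ts

mutual

  climb-word : ∀ (t : Tree m M) {a} → Climb m a (word t) a
  climb-word leaf          = []
  climb-word (node Q t ts) = up (climb-++ (climb-word t) (climb-wordF ts))

  climb-wordF : ∀ (ts : Forest m M n) {a} → Climb m (n + a) (wordF ts) a
  climb-wordF []       = []
  climb-wordF (t ∷ ts) = down (climb-++ (climb-word t) (climb-wordF ts))

mutual

  size : Tree m M → ℕ
  size leaf          = 0
  size (node Q t ts) = suc (size t + sizeF ts)

  sizeF : Forest m M n → ℕ
  sizeF []       = 0
  sizeF (t ∷ ts) = size t + sizeF ts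

#U-++ : ∀ v w → #U (v ++ w) ≡ #U v + #U w
#U-++ v w = trans (cong length (filter-++ (_≟ˢ U) v w)) (length-++ (filter (_≟ˢ U) v))

#R-++ : ∀ v w → #R (v ++ w) ≡ #R v + #R w
#R-++ v w = trans (cong length (filter-++ (_≟ˢ R) v w)) (length-++ (filter (_≟ˢ R) v))

mutual

  #U-word : (t : Tree m M) → #U (word t) ≡ size t
  #U-word leaf          = refl
  #U-word (node Q t ts) =
    cong suc (trans (#U-++ (word t) _) (cong₂ _+_ (#U-word t) (#U-wordF ts)))

  #U-wordF : (ts : Forest m M n) → #U (wordF ts) ≡ sizeF ts
  #U-wordF []       = refl
  #U-wordF (t ∷ ts) = trans (#U-++ (word t) _) (cong₂ _+_ (#U-word t) (#U-wordF ts))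

mutual

  #R-word : (t : Tree m M) → #R (word t) ≡ m * size t
  #R-word {m} leaf = sym (*-zeroʳ m)
  #R-word {m} (node Q t ts) = begin
    #R (word t ++ wordF ts)           ≡⟨ #R-++ (word t) _ ⟩
    #R (word t) + #R (wordF ts)       ≡⟨ cong₂ _+_ (#R-word t) (#R-wordF ts) ⟩
    m * size t + (m + m * sizeF ts)   ≡⟨ +-assoc (m * size t) m _ ⟨
    m * size t + m + m * sizeF ts     ≡⟨ cong (λ x → x + m * sizeF ts) (+-comm (m * size t) m) ⟩
    m + m * size t + m * sizeF ts     ≡⟨ +-assoc m (m * size t) _ ⟩
    m + (m * size t + m * sizeF ts)   ≡⟨ cong (λ x → m + x) (*-distribˡ-+ m (size t) (sizeF ts)) ⟨
    m + m * (size t + sizeF ts)       ≡⟨ *-suc m (size t + sizeF ts) ⟨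
    m * suc (size t + sizeF ts)       ∎
    where open ≡-Reasoning

  #R-wordF : (ts : Forest m M n) → #R (wordF ts) ≡ n + m * sizeF ts
  #R-wordF {m} [] = sym (*-zeroʳ m)
  #R-wordF {m} {n = suc n} (t ∷ ts) = cong suc (begin
    #R (word t ++ wordF ts)           ≡⟨ #R-++ (word t) _ ⟩
    #R (word t) + #R (wordF ts)       ≡⟨ cong₂ _+_ (#R-word t) (#R-wordF ts) ⟩
    m * size t + (n + m * sizeF ts)   ≡⟨ +-assoc (m * size t) n _ ⟨
    m * size t + n + m * sizeF ts     ≡⟨ cong (λ x → x + m * sizeF ts) (+-comm (m * size t) n) ⟩
    n + m * size t + m * sizeF ts     ≡⟨ +-assoc n (m * size t) _ ⟩
    n + (m * size t + m * sizeF ts)   ≡⟨ cong (λ x → n + x) (*-distribˡ-+ m (size t) (sizeF ts)) ⟨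
    n + m * (size t + sizeF ts)       ∎)
    where open ≡-Reasoning

-- One block per node of the left spine, the deepest first: the part of the node's word behind the R
-- that follows its first subtree. This R exists because m is a successor.
blocks : ∀ {k} → Tree (suc k) M → List Word
blocks leaf                = []
blocks (node Q t (t′ ∷ ts)) = blocks t ∷ʳ (word t′ ++ wordF ts)

module _ {k M : ℕ} where

  blocks-good : (t : Tree (suc k) M) → All (Block k) (blocks t)
  blocks-good leaf = []
  blocks-good (node Q t (t′ ∷ ts)) = All.++⁺ (blocks-good t)
    (climb-++ (climb-word t′) (subst (λ x → Climb (suc k) x (wordF ts) 0) (+-identityʳ k) (climb-wordF ts)) ∷ [])

  word-blocks : (t : Tree (suc k) M) →
    word t ≡ replicate (length (blocks t)) U ++ concatMap (R ∷_) (blocks t)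
  word-blocks leaf = refl
  word-blocks (node Q t (t′ ∷ ts)) = begin
      U ∷ word t ++ R ∷ B
    ≡⟨ cong (λ x → U ∷ x ++ R ∷ B) (word-blocks t) ⟩
      U ∷ (Us ++ concatMap (R ∷_) bs) ++ R ∷ B
    ≡⟨ cong (U ∷_) (++-assoc Us _ _) ⟩
      U ∷ Us ++ concatMap (R ∷_) bs ++ R ∷ B
    ≡⟨ cong (λ x → U ∷ Us ++ concatMap (R ∷_) bs ++ x) (++-identityʳ (R ∷ B)) ⟨
      U ∷ Us ++ concatMap (R ∷_) bs ++ concatMap (R ∷_) [ B ]
    ≡⟨ cong (λ x → U ∷ Us ++ x) (concatMap-++ (R ∷_) bs [ B ]) ⟨
      U ∷ Us ++ concatMap (R ∷_) (bs ∷ʳ B)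
    ≡⟨ cong (λ x → replicate x U ++ concatMap (R ∷_) (bs ∷ʳ B)) (trans (length-++ bs) (+-comm (length bs) 1)) ⟨
      replicate (length (bs ∷ʳ B)) U ++ concatMap (R ∷_) (bs ∷ʳ B)
    ∎
    where
    open ≡-Reasoning
    B = word t′ ++ wordF ts
    bs = blocks t
    Us = replicate (length bs) U

  rot-word : ∀ Q t (ts : Forest (suc k) M (suc k)) →
    rot (suc k) (word (node Q t ts)) ≡ concatMap (λ B → U ∷ B ∷ʳ R) (blocks (node Q t ts))
  -- `blocks` grows at its right end, so the list is generalised to a variable that can be matched
  -- as a cons; its length excludes the empty case.
  rot-word Q t ts@(_ ∷ _) = rotate (blocks (node Q t ts)) (word-blocks (node Q t ts))
      (blocks-good (node Q t ts)) (λ eq → 0≢1+n (trans (sym eq) (trans (length-++ (blocks t)) (+-comm _ 1))))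
    where
    rotate : ∀ {w} Bs → w ≡ replicate (length Bs) U ++ concatMap (R ∷_) Bs → All (Block k) Bs →
             length Bs ≢ 0 → rot (suc k) w ≡ concatMap (λ B → U ∷ B ∷ʳ R) Bs
    rotate []       eq good ne = contradiction refl ne
    rotate (B ∷ Bs) eq good ne = trans (cong (rot (suc k)) eq) (rot-blocks k B Bs good)

-- Sequences of visits and their transcription.

-- The sweep over the edge spanned by t and the subgons below it meets them in the
-- order visits t; it starts with the subgons at the left end of this edge, spine t.
mutual

  visits : Tree m M → List (Subset M)
  visits leaf          = []
  visits (node Q t ts) = Q ∷ visits t ++ visitsF Q ts

  visitsF : Subset M → Forest m M n → List (Subset M)
  visitsF Q []       = [ Q ]
  visitsF Q (t ∷ ts) = Q ∷ visits t ++ visitsF Q ts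

spine : Tree m M → List (Subset M)
spine leaf          = []
spine (node Q t ts) = Q ∷ spine t

-- What follows the survey at the left end. It still contains all later visits to the spine subgons.
offspine : Tree m M → List (Subset M)
offspine leaf          = []
offspine (node Q t ts) = offspine t ++ visitsF Q ts

spine-offspine : (t : Tree m M) → visits t ≡ spine t ++ offspine t
spine-offspine leaf = refl
spine-offspine (node Q t ts) =
  cong (Q ∷_) (trans (cong (_++ visitsF Q ts) (spine-offspine t)) (++-assoc (spine t) _ _))

mutual

  labels : Tree m M → List (Subset M)
  labels leaf          = []
  labels (node Q t ts) = Q ∷ labels t ++ labelsF ts

  labelsF : Forest m M n → List (Subset M)
  labelsF []       = []
  labelsF (t ∷ ts) = labels t ++ labelsF ts

spine⊆labels : ∀ (t : Tree m M) {S} → S List.∈ spine t → S List.∈ labels t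
spine⊆labels (node Q t ts) (here refl) = here refl
spine⊆labels (node Q t ts) (there p)   = there (∈-++⁺ˡ (spine⊆labels t p))

occ : Subset M → List (Subset M) → ℕ
occ S xs = length (filter (S ≟ˢᵘᵇ_) xs)

occ-++ : ∀ (S : Subset M) xs ys → occ S (xs ++ ys) ≡ occ S xs + occ S ys
occ-++ S xs ys = trans (cong length (filter-++ (S ≟ˢᵘᵇ_) xs ys)) (length-++ (filter (S ≟ˢᵘᵇ_) xs))

occ-here : ∀ (S : Subset M) xs → occ S (S ∷ xs) ≡ suc (occ S xs)
occ-here S xs = cong length (filter-accept (S ≟ˢᵘᵇ_) refl)

occ-skip : ∀ {S Q : Subset M} xs → S ≢ Q → occ S (Q ∷ xs) ≡ occ S xs
occ-skip {S = S} xs S≢Q = cong length (filter-reject (S ≟ˢᵘᵇ_) S≢Q)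

occ-ʳ++ : ∀ (S : Subset M) xs ys → occ S (xs ʳ++ ys) ≡ occ S xs + occ S ys
occ-ʳ++ S [] ys = refl
occ-ʳ++ S (x ∷ xs) ys = begin
  occ S (xs ʳ++ (x ∷ ys))                ≡⟨ occ-ʳ++ S xs (x ∷ ys) ⟩
  occ S xs + occ S (x ∷ ys)              ≡⟨ cong (λ c → occ S xs + c) (occ-++ S [ x ] ys) ⟩
  occ S xs + (occ S [ x ] + occ S ys)    ≡⟨ +-assoc (occ S xs) _ _ ⟨
  occ S xs + occ S [ x ] + occ S ys      ≡⟨ cong (λ c → c + occ S ys) (+-comm (occ S xs) _) ⟩
  occ S [ x ] + occ S xs + occ S ys      ≡⟨ cong (λ c → c + occ S ys) (occ-++ S [ x ] xs) ⟨
  occ S (x ∷ xs) + occ S ys              ∎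
  where open ≡-Reasoning

mutual

  occ-visits : ∀ (t : Tree m M) {S} → S List.∉ labels t → occ S (visits t) ≡ 0
  occ-visits leaf S∉ = refl
  occ-visits (node Q t ts) {S} S∉ = trans (occ-skip (visits t ++ visitsF Q ts) (S∉ ∘ here))
    (trans (occ-++ S (visits t) _)
      (cong₂ _+_ (occ-visits t (S∉ ∘ there ∘ ∈-++⁺ˡ))
                 (occ-visitsF ts (S∉ ∘ here) (S∉ ∘ there ∘ ∈-++⁺ʳ (labels t)))))

  occ-visitsF : ∀ (ts : Forest m M n) {S Q} → S ≢ Q → S List.∉ labelsF ts → occ S (visitsF Q ts) ≡ 0
  occ-visitsF [] S≢Q S∉ = occ-skip [] S≢Q
  occ-visitsF (t ∷ ts) {S} {Q} S≢Q S∉ = trans (occ-skip (visits t ++ visitsF Q ts) S≢Q)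
    (trans (occ-++ S (visits t) _)
      (cong₂ _+_ (occ-visits t (S∉ ∘ ∈-++⁺ˡ)) (occ-visitsF ts S≢Q (S∉ ∘ ∈-++⁺ʳ (labels t)))))

occ-visitsF-self : ∀ (ts : Forest m M n) {Q} → Q List.∉ labelsF ts → occ Q (visitsF Q ts) ≡ suc n
occ-visitsF-self [] {Q} Q∉ = occ-here Q []
occ-visitsF-self (t ∷ ts) {Q} Q∉ = trans (occ-here Q (visits t ++ visitsF Q ts))
  (cong suc (trans (occ-++ Q (visits t) _)
    (cong₂ _+_ (occ-visits t (Q∉ ∘ ∈-++⁺ˡ)) (occ-visitsF-self ts (Q∉ ∘ ∈-++⁺ʳ (labels t))))))

occ-offspine-∉ : ∀ (t : Tree m M) {S} → S List.∉ labels t → occ S (offspine t) ≡ 0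
occ-offspine-∉ leaf S∉ = refl
occ-offspine-∉ (node Q t ts) {S} S∉ = trans (occ-++ S (offspine t) _)
  (cong₂ _+_ (occ-offspine-∉ t (S∉ ∘ there ∘ ∈-++⁺ˡ))
             (occ-visitsF ts (S∉ ∘ here) (S∉ ∘ there ∘ ∈-++⁺ʳ (labels t))))

-- Only the first visit to a spine subgon is missing. The others are in its own `visitsF`: one
-- before each of its last m subtrees and one at the end.
occ-offspine : ∀ (t : Tree m M) → Unique (labels t) → ∀ {S} → S List.∈ spine t → occ S (offspine t) ≡ suc m
occ-offspine (node Q t ts) (Q# ∷ u) {S} S∈ with unique-++⁻ (labels t) u | S∈
... | ut , uts , dis | here refl = trans (occ-++ S (offspine t) _)
  (cong₂ _+_ (occ-offspine-∉ t (λ p → All.lookup Q# (∈-++⁺ˡ p) refl))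
             (occ-visitsF-self ts (λ p → All.lookup Q# (∈-++⁺ʳ (labels t) p) refl)))
... | ut , uts , dis | there p = trans (occ-++ S (offspine t) _)
  (trans (cong₂ _+_ (occ-offspine t ut p)
    (occ-visitsF ts (≢-sym (All.lookup Q# (∈-++⁺ˡ S∈t))) (dis S∈t))) (+-identityʳ _))
  where S∈t = spine⊆labels t p

transcribe-++ : ∀ m (seen xs : List (Subset M)) ys →
  transcribe m seen (xs ++ ys) ≡ transcribe m seen xs ++ transcribe m (xs ʳ++ seen) ys
transcribe-++ m seen []       ys = refl
transcribe-++ m seen (x ∷ xs) ys = trans
  (cong (letter m (occ x seen) ++_) (transcribe-++ m (x ∷ seen) xs ys))
  (sym (++-assoc (letter m (occ x seen)) _ _))

letter-last : ∀ m → letter m (suc m) ≡ []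
letter-last m with suc (suc m) ≟ m + 2
... | yes _ = refl
... | no ne = contradiction (+-comm 2 m) ne

letter-R : ∀ {m} c → suc c ≤ m → letter m (suc c) ≡ [ R ]
letter-R {m} c c<m with suc (suc c) ≟ m + 2
... | yes eq = contradiction (suc-injective (suc-injective (trans eq (+-comm m 2)))) (<⇒≢ c<m)
... | no _   = refl

-- The letters of visitsF Q ts if Q has been met c times before.
letters : ℕ → Forest m M n → Word
letters {m} c []       = letter m c
letters {m} c (t ∷ ts) = letter m c ++ word t ++ letters (suc c) ts

-- The hypothesis makes the closing visit number m + 2, which is silent. Counts start at `suc c`, so
-- no U occurs among the visits to the node itself.
letters-wordF : ∀ c (ts : Forest m M n) → n + c ≡ m → letters (suc c) ts ≡ wordF ts
letters-wordF c [] refl = letter-last c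
letters-wordF {n = suc n} c (t ∷ ts) refl = cong₂ _++_ (letter-R c (s≤s (m≤n+m c n)))
  (cong (word t ++_) (letters-wordF (suc c) ts (+-suc n c)))

-- With one visit fewer behind it, the closing visit is number m + 1 and gives the R that a block
-- gains by the rotation.
letters-wordF-R : ∀ c (ts : Forest m M n) → suc (n + c) ≡ m → letters (suc c) ts ≡ wordF ts ∷ʳ R
letters-wordF-R c [] refl = letter-R c ≤-refl
letters-wordF-R {n = suc n} c (t ∷ ts) refl = cong₂ _++_ (letter-R c (s≤s (m≤n⇒m≤1+n (m≤n+m c n))))
  (trans (cong (word t ++_) (letters-wordF-R (suc c) ts (cong suc (+-suc n c)))) (sym (++-assoc (word t) _ _)))

Unseen : List (Subset M) → List (Subset M) → Set
Unseen seen xs = ∀ {S} → S List.∈ xs → occ S seen ≡ 0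

occ-after : ∀ {S : Subset M} {xs seen a b} → occ S xs ≡ a → occ S seen ≡ b → occ S (xs ʳ++ seen) ≡ a + b
occ-after {S = S} {xs} {seen} p q = trans (occ-ʳ++ S xs seen) (cong₂ _+_ p q)

mutual

  -- Uniqueness of the labels keeps the visits inside one subtree from changing the counts
  -- elsewhere. `seen` is general because earlier siblings and ancestors have already been met.
  transcribe-visits : ∀ {seen} (t : Tree m M) → Unique (labels t) → Unseen seen (labels t) →
                      transcribe m seen (visits t) ≡ word t
  transcribe-visits leaf u new = refl
  transcribe-visits {m} {seen = seen} (node Q t ts) (Q# ∷ u) new with unique-++⁻ (labels t) u
  ... | ut , uts , dis = begin
      letter m (occ Q seen) ++ transcribe m (Q ∷ seen) (visits t ++ visitsF Q ts)
    ≡⟨ cong₂ (λ x y → letter m x ++ y) (new (here refl)) (transcribe-++ m (Q ∷ seen) (visits t) _) ⟩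
      U ∷ transcribe m (Q ∷ seen) (visits t) ++ transcribe m (visits t ʳ++ (Q ∷ seen)) (visitsF Q ts)
    ≡⟨ cong₂ (λ x y → U ∷ x ++ y)
        (transcribe-visits t ut (λ S∈ → trans (occ-skip seen (≢-sym (Q≢ (∈-++⁺ˡ S∈)))) (new (there (∈-++⁺ˡ S∈)))))
        (transcribe-visitsF 1 ts uts (λ Q∈ → Q≢ (∈-++⁺ʳ (labels t) Q∈) refl)
          (λ S∈ → occ-after {xs = visits t} (occ-visits t (λ S∈t → dis S∈t S∈))
             (trans (occ-skip seen (≢-sym (Q≢ (∈-++⁺ʳ (labels t) S∈))))
               (new (there (∈-++⁺ʳ (labels t) S∈)))))
          (occ-after {xs = visits t} (occ-visits t (λ Q∈ → Q≢ (∈-++⁺ˡ Q∈) refl))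
            (trans (occ-here Q seen) (cong suc (new (here refl)))))) ⟩
      U ∷ word t ++ letters 1 ts
    ≡⟨ cong (λ x → U ∷ word t ++ x) (letters-wordF 0 ts (+-identityʳ m)) ⟩
      U ∷ word t ++ wordF ts
    ∎
    where
    open ≡-Reasoning
    Q≢ : ∀ {S} → S List.∈ labels t ++ labelsF ts → Q ≢ S
    Q≢ = All.lookup Q#

  -- The count c starts at 1 under `visits`, and at 0 under `offspine`, where the opening visit to Q
  -- is absent.
  transcribe-visitsF : ∀ {seen Q} c (ts : Forest m M n) → Unique (labelsF ts) → Q List.∉ labelsF ts →
                       Unseen seen (labelsF ts) → occ Q seen ≡ c →
                       transcribe m seen (visitsF Q ts) ≡ letters c ts
  transcribe-visitsF {m} c [] u Q∉ new occ≡ = trans (++-identityʳ _) (cong (letter m) occ≡)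
  transcribe-visitsF {m} {seen = seen} {Q} c (t ∷ ts) u Q∉ new occ≡ with unique-++⁻ (labels t) u
  ... | ut , uts , dis = begin
      letter m (occ Q seen) ++ transcribe m (Q ∷ seen) (visits t ++ visitsF Q ts)
    ≡⟨ cong₂ (λ x y → letter m x ++ y) occ≡ (transcribe-++ m (Q ∷ seen) (visits t) _) ⟩
      letter m c ++ transcribe m (Q ∷ seen) (visits t) ++ transcribe m (visits t ʳ++ (Q ∷ seen)) (visitsF Q ts)
    ≡⟨ cong₂ (λ x y → letter m c ++ x ++ y)
        (transcribe-visits t ut (λ S∈ → trans (occ-skip seen (≢Q (∈-++⁺ˡ S∈))) (new (∈-++⁺ˡ S∈))))
        (transcribe-visitsF (suc c) ts uts (Q∉ ∘ ∈-++⁺ʳ (labels t))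
          (λ S∈ → occ-after {xs = visits t} (occ-visits t (λ S∈t → dis S∈t S∈))
             (trans (occ-skip seen (≢Q (∈-++⁺ʳ (labels t) S∈))) (new (∈-++⁺ʳ (labels t) S∈))))
          (occ-after {xs = visits t} (occ-visits t (Q∉ ∘ ∈-++⁺ˡ))
            (trans (occ-here Q seen) (cong suc occ≡)))) ⟩
      letter m c ++ word t ++ letters (suc c) ts
    ∎
    where
    open ≡-Reasoning
    ≢Q : ∀ {S} → S List.∈ labels t ++ labelsF ts → S ≢ Q
    ≢Q S∈ refl = Q∉ S∈

-- Without the opening visit, the visit that used to give the first R gives U, and the one that used
-- to be silent gives R.
transcribe-offspine : ∀ {k seen} (t : Tree (suc k) M) → Unique (labels t) → Unseen seen (labels t) →
  transcribe (suc k) seen (offspine t) ≡ concatMap (λ B → U ∷ B ∷ʳ R) (blocks t)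
transcribe-offspine leaf u new = refl
transcribe-offspine {k = k} {seen} (node Q t ts@(t′ ∷ ts′)) (Q# ∷ u) new with unique-++⁻ (labels t) u
... | ut , uts , dis = begin
    transcribe (suc k) seen (offspine t ++ visitsF Q ts)
  ≡⟨ transcribe-++ (suc k) seen (offspine t) _ ⟩
    transcribe (suc k) seen (offspine t) ++ transcribe (suc k) (offspine t ʳ++ seen) (visitsF Q ts)
  ≡⟨ cong₂ _++_ (transcribe-offspine t ut (new ∘ there ∘ ∈-++⁺ˡ))
       (transcribe-visitsF 0 ts uts (λ Q∈ → Q≢ (∈-++⁺ʳ (labels t) Q∈) refl)
         (λ S∈ → occ-after {xs = offspine t} (occ-offspine-∉ t (λ S∈t → dis S∈t S∈))
            (new (there (∈-++⁺ʳ (labels t) S∈))))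
         (occ-after {xs = offspine t} (occ-offspine-∉ t (λ Q∈ → Q≢ (∈-++⁺ˡ Q∈) refl)) (new (here refl)))) ⟩
    concatMap f (blocks t) ++ U ∷ word t′ ++ letters 1 ts′
  ≡⟨ cong (λ x → concatMap f (blocks t) ++ U ∷ x) (trans
       (cong (word t′ ++_) (letters-wordF-R 0 ts′ (cong suc (+-identityʳ k)))) (sym (++-assoc (word t′) _ _))) ⟩
    concatMap f (blocks t) ++ f B
  ≡⟨ cong (concatMap f (blocks t) ++_) (++-identityʳ (f B)) ⟨
    concatMap f (blocks t) ++ concatMap f [ B ]
  ≡⟨ concatMap-++ f (blocks t) [ B ] ⟨
    concatMap f (blocks t ∷ʳ B)
  ∎
  where
  open ≡-Reasoning
  f : Word → Word
  f B = U ∷ B ∷ʳ R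
  B = word t′ ++ wordF ts′
  Q≢ : ∀ {S} → S List.∈ labels t ++ labelsF ts → Q ≢ S
  Q≢ = All.lookup Q#

transcribe-spine : ∀ {seen} (t : Tree m M) → Unique (labels t) →
  (∀ {S} → S List.∈ spine t → occ S seen ≡ suc m) → transcribe m seen (spine t) ≡ []
transcribe-spine leaf u old = refl
transcribe-spine {m} {seen = seen} (node Q t ts) (Q# ∷ u) old = cong₂ _++_
  (trans (cong (letter m) (old (here refl))) (letter-last m))
  (transcribe-spine t (proj₁ (unique-++⁻ (labels t) u))
    (λ S∈ → trans (occ-skip seen (≢-sym (All.lookup Q# (∈-++⁺ˡ (spine⊆labels t S∈))))) (old (there S∈))))

transcribe-rotated : ∀ {k} (t : Tree (suc k) M) → Unique (labels t) →
  transcribe (suc k) [] (offspine t ++ spine t) ≡ concatMap (λ B → U ∷ B ∷ʳ R) (blocks t)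
transcribe-rotated {k = k} t u = trans (transcribe-++ (suc k) [] (offspine t) (spine t)) (trans
  (cong₂ _++_ (transcribe-offspine t u (λ _ → refl))
    (transcribe-spine t u (λ {S} S∈ →
      trans (occ-ʳ++ S (offspine t) []) (trans (+-identityʳ _) (occ-offspine t u S∈)))))
  (++-identityʳ _))

-- The cyclic order of the vertices.

cw-irrefl : ¬ Clockwise a b b
cw-irrefl (inj₁ (_ , p))        = Fin.<-irrefl refl p
cw-irrefl (inj₂ (inj₁ (p , _))) = Fin.<-irrefl refl p
cw-irrefl (inj₂ (inj₂ (p , q))) = Fin.<-asym p q

cw-trans : Clockwise a b c → Clockwise a c d → Clockwise a b d
cw-trans (inj₁ (p , q))        (inj₁ (r , s))        = inj₁ (p , Fin.<-trans q s)
cw-trans (inj₁ (p , q))        (inj₂ (inj₁ (r , s))) =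
  contradiction (Fin.<-trans p (Fin.<-trans q r)) (Fin.<-asym s)
cw-trans (inj₁ (p , q))        (inj₂ (inj₂ (r , s))) = inj₂ (inj₂ (r , p))
cw-trans (inj₂ (inj₁ (p , q))) (inj₁ (r , s))        = contradiction q (Fin.<-asym r)
cw-trans (inj₂ (inj₁ (p , q))) (inj₂ (inj₁ (r , s))) = inj₂ (inj₁ (Fin.<-trans p r , s))
cw-trans (inj₂ (inj₁ (p , q))) (inj₂ (inj₂ (r , s))) = contradiction q (Fin.<-asym s)
cw-trans (inj₂ (inj₂ (p , q))) (inj₁ (r , s))        = contradiction p (Fin.<-asym r)
cw-trans (inj₂ (inj₂ (p , q))) (inj₂ (inj₁ (r , s))) = inj₂ (inj₂ (s , q))
cw-trans (inj₂ (inj₂ (p , q))) (inj₂ (inj₂ (r , s))) = contradiction p (Fin.<-asym s)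

cw-tail : Clockwise a b c → Clockwise a c d → Clockwise b c d
cw-tail p q = turn (turn (cw-trans (turn q) (turn (turn p))))

cw-total : {a b c : Fin M} → a ≢ b → b ≢ c → a ≢ c → Clockwise a b c ⊎ Clockwise a c b
cw-total {a = a} {b} {c} a≢b b≢c a≢c with Fin.<-cmp a b | Fin.<-cmp b c | Fin.<-cmp a c
... | tri≈ _ eq _ | _           | _           = contradiction eq a≢b
... | _           | tri≈ _ eq _ | _           = contradiction eq b≢c
... | _           | _           | tri≈ _ eq _ = contradiction eq a≢c
... | tri< p _ _  | tri< q _ _  | _           = inj₁ (inj₁ (p , q))
... | tri< p _ _  | tri> _ _ q  | tri< r _ _  = inj₂ (inj₁ (r , q))
... | tri< p _ _  | tri> _ _ q  | tri> _ _ r  = inj₁ (inj₂ (inj₂ (r , p)))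
... | tri> _ _ p  | tri< q _ _  | tri< r _ _  = inj₂ (inj₂ (inj₂ (p , r)))
... | tri> _ _ p  | tri< q _ _  | tri> _ _ r  = inj₁ (inj₂ (inj₁ (q , r)))
... | tri> _ _ p  | tri> _ _ q  | _           = inj₂ (inj₂ (inj₁ (q , p)))

cw-next : ¬ Clockwise a x (next a)
cw-next {suc n} {a} {x} cw with view a
cw-next {suc n} {x = x} (inj₁ (p , q)) | ‵fromℕ = fromℕ≮ x p
cw-next {suc n} (inj₂ (inj₂ (p , q))) | ‵fromℕ = fromℕ≮ _ q
cw-next {suc n} (inj₁ (p , s≤s q)) | ‵inject₁ j =
  <-irrefl refl (≤-trans (subst (λ z → suc z ≤ _) (toℕ-inject₁ j) p) q)
cw-next {suc n} (inj₂ (inj₁ (p , q))) | ‵inject₁ j =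
  <-asym (n<1+n (toℕ j)) (subst (suc (suc (toℕ j)) ≤_) (toℕ-inject₁ j) q)
cw-next {suc n} (inj₂ (inj₂ (p , q))) | ‵inject₁ j =
  <-asym (n<1+n (toℕ j)) (subst (suc (suc (toℕ j)) ≤_) (toℕ-inject₁ j) p)

-- Cutting the circle open at x makes an order of the ternary relation; well-founded search in it
-- finds the nearest element of a set on either side of x.
cw-order : ∀ (x : Fin M) → IsStrictPartialOrder _≡_ (Clockwise x)
cw-order x = record
  { isEquivalence = isEquivalence
  ; irrefl        = λ { refl → cw-irrefl }
  ; trans         = cw-trans
  ; <-resp-≈      = (λ { refl p → p }) , (λ { refl p → p })
  }

module _ {P : Pred (Fin M) 0ℓ} (P? : Decidable P)
         {_⊏_ : Rel (Fin M) 0ℓ} (_⊏?_ : Binary.Decidable _⊏_) (wf : WellFounded _⊏_) where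

  minimal : ∀ {y} → P y → ∃[ z ] P z × (∀ w → P w → ¬ w ⊏ z)
  minimal {y} = go y (wf y)
    where
    go : ∀ y → Acc _⊏_ y → P y → ∃[ z ] P z × (∀ w → P w → ¬ w ⊏ z)
    go y (acc rs) py with any? (λ w → P? w ×-dec (w ⊏? y))
    ... | yes (w , pw , w⊏y) = go w (rs w⊏y) pw
    ... | no none            = y , py , λ w pw w⊏y → none (w , pw , w⊏y)

opaque

  successor : ∀ {x y} {Q : Subset M} → x ∈ Q → y ∈ Q → y ≢ x → ∃[ z ] Consecutive Q x z
  successor {x = x} {Q = Q} x∈ y∈ y≢
    with minimal (λ z → (z ∈? Q) ×-dec ¬? (z ≟ᶠ x)) (clockwise? x)
           (spo-wellFounded (cw-order x)) (y∈ , y≢)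
  ... | z , (z∈ , z≢) , least = z , x∈ , z∈ , ≢-sym z≢ ,
    λ w w∈ cw → least w (w∈ , λ { refl → cw-irrefl (turn (turn cw)) }) cw

  predecessor : ∀ {x y} {Q : Subset M} → x ∈ Q → y ∈ Q → y ≢ x → ∃[ z ] Consecutive Q z x
  predecessor {x = x} {Q = Q} x∈ y∈ y≢
    with minimal (λ z → (z ∈? Q) ×-dec ¬? (z ≟ᶠ x)) (flip (clockwise? x))
           (spo-noetherian (cw-order x)) (y∈ , y≢)
  ... | z , (z∈ , z≢) , greatest = z , z∈ , x∈ , z≢ ,
    λ w w∈ cw → greatest w (w∈ , λ { refl → cw-irrefl cw }) (turn (turn cw))

  gap : ∀ {x y z} {Q : Subset M} → x ∉ Q → y ∈ Q → z ∈ Q → y ≢ z →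
        ∃[ u ] ∃[ v ] Consecutive Q u v × Clockwise u x v
  gap {x = x} {y} {z} {Q} x∉ y∈ z∈ y≢z with minimal (_∈? Q) (clockwise? x) (spo-wellFounded (cw-order x)) y∈
  -- v is the first element of Q after x, so the element of Q preceding v must lie on the other side
  -- of x.
  ... | v , v∈ , least with predecessor v∈ (proj₁ (proj₂ other)) (proj₂ (proj₂ other))
    where
    other : ∃[ w ] w ∈ Q × w ≢ v
    other with y ≟ᶠ v
    ... | yes refl = z , z∈ , ≢-sym y≢z
    ... | no y≢    = y , y∈ , y≢
  ... | u , con@(u∈ , _ , u≢v , _) with cw-total {a = u} {x} {v} (λ { refl → x∉ u∈ }) (λ { refl → x∉ v∈ }) u≢v
  ... | inj₁ cw = u , v , con , cw
  ... | inj₂ cw = contradiction (turn (turn cw)) (least u u∈)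

-- Counting the elements of vertex sets.

remove : Fin n → Subset n → Subset n
remove x Q = Q [ x ]≔ outside

∣Q∣≤1+∣remove∣ : ∀ (Q : Subset n) x → ∣ Q ∣ ≤ suc ∣ remove x Q ∣
∣Q∣≤1+∣remove∣ (inside ∷ Q)  zero    = ≤-refl
∣Q∣≤1+∣remove∣ (outside ∷ Q) zero    = n≤1+n _
∣Q∣≤1+∣remove∣ (inside ∷ Q)  (suc x) = s≤s (∣Q∣≤1+∣remove∣ Q x)
∣Q∣≤1+∣remove∣ (outside ∷ Q) (suc x) = ∣Q∣≤1+∣remove∣ Q x

x∉remove : ∀ (Q : Subset n) x → x ∉ remove x Q
x∉remove (s ∷ Q) zero    ()
x∉remove (s ∷ Q) (suc x) (there p) = x∉remove Q x p

remove-⊆ : ∀ (Q : Subset n) x → remove x Q ⊆ Q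
remove-⊆ (s ∷ Q) zero    (there p) = there p
remove-⊆ (s ∷ Q) (suc x) here      = here
remove-⊆ (s ∷ Q) (suc x) (there p) = there (remove-⊆ Q x p)

∈-remove : ∀ {Q : Subset n} {x y} → y ∈ Q → y ≢ x → y ∈ remove x Q
∈-remove {x = zero}  here      y≢x = contradiction refl y≢x
∈-remove {x = suc x} here      y≢x = here
∈-remove {x = zero}  (there p) y≢x = there p
∈-remove {x = suc x} (there p) y≢x = there (∈-remove p (y≢x ∘ cong suc))

∣remove∣<∣Q∣ : ∀ {Q : Subset n} {x} → x ∈ Q → suc ∣ remove x Q ∣ ≤ ∣ Q ∣
∣remove∣<∣Q∣ {Q = Q} {x} x∈ = p⊂q⇒∣p∣<∣q∣ (remove-⊆ Q x , x , x∈ , x∉remove Q x)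

∣Q∣-empty : {Q : Subset n} → (∀ x → x ∉ Q) → ∣ Q ∣ ≡ 0
∣Q∣-empty {n} none = trans (cong ∣_∣ (Empty-unique λ { (x , x∈) → none x x∈ })) (∣⊥∣≡0 n)

length-elements : ∀ (es : List (Fin n)) (Q : Subset n) → Unique es → (∀ {x} → x ∈ Q → x List.∈ es) →
                  All (_∈ Q) es → length es ≡ ∣ Q ∣
length-elements [] Q u cover sound = sym (∣Q∣-empty λ x x∈ → contradiction (cover x∈) λ ())
length-elements (e ∷ es) Q (e# ∷ u) cover (e∈ ∷ sound) = ≤-antisym
  (subst (λ k → suc k ≤ ∣ Q ∣) (sym rec) (∣remove∣<∣Q∣ e∈))
  (subst (λ k → ∣ Q ∣ ≤ suc k) (sym rec) (∣Q∣≤1+∣remove∣ Q e))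
  where
  remaining : ∀ {x} → x ∈ remove e Q → x List.∈ es
  remaining {x} x∈ with cover (remove-⊆ Q e x∈)
  ... | here refl = contradiction x∈ (x∉remove Q e)
  ... | there p   = p
  rec : length es ≡ ∣ remove e Q ∣
  rec = length-elements es (remove e Q) u remaining
    (All.zipWith (λ { (x∈ , e≢x) → ∈-remove x∈ (≢-sym e≢x) }) (sound , e#))

third : ∀ {Q : Subset M} → 3 ≤ ∣ Q ∣ → ∀ x y → ∃[ z ] z ∈ Q × z ≢ x × z ≢ y
third {Q = Q} 3≤ x y with any? (λ z → (z ∈? Q) ×-dec ¬? (z ≟ᶠ x) ×-dec ¬? (z ≟ᶠ y))
... | yes found = found
... | no none = contradiction (≤-trans 3≤ (≤-trans (∣Q∣≤1+∣remove∣ Q x) (s≤s (∣Q∣≤1+∣remove∣ (remove x Q) y))))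
  λ le → <-irrefl refl (subst (λ k → 3 ≤ suc (suc k)) (∣Q∣-empty nothing) le)
  where
  nothing : ∀ z → z ∉ remove y (remove x Q)
  nothing z z∈ = none (z , remove-⊆ Q x (remove-⊆ (remove x Q) y z∈) ,
    (λ { refl → x∉remove Q x (remove-⊆ (remove x Q) y z∈) }) , (λ { refl → x∉remove (remove x Q) y z∈ }))

three : ∀ {Q : Subset M} {x y z} → x ∈ Q → y ∈ Q → z ∈ Q → x ≢ y → x ≢ z → y ≢ z → 3 ≤ ∣ Q ∣
three x∈ y∈ z∈ x≢y x≢z y≢z =
  ≤-trans (s≤s (≤-trans (s≤s (≤-trans (s≤s z≤n) (∣remove∣<∣Q∣ z∈′))) (∣remove∣<∣Q∣ y∈′)))
    (∣remove∣<∣Q∣ x∈)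
  where
  y∈′ = ∈-remove y∈ (≢-sym x≢y)
  z∈′ = ∈-remove (∈-remove z∈ (≢-sym x≢z)) (≢-sym y≢z)

-- A subgon is determined by one directed side.

module _ {D : Rel (Fin M) 0ℓ}
         (noncrossing : ∀ {a b c d} → D a b → D c d → ¬ Crossing a b c d) where
  open IsSubgon

  private
    variable
      p q r s : Fin M

  Edge : Rel (Fin M) 0ℓ
  Edge a b = Side a b ⊎ D a b

  not-two : IsSubgon D Q → Consecutive Q p q → ¬ Consecutive Q q p
  not-two {p = p} {q} sub (p∈ , q∈ , p≢q , gap₁) (_ , _ , _ , gap₂)
    with third (nondegenerate sub) p q
  ... | z , z∈ , z≢p , z≢q with cw-total {a = p} {q} {z} p≢q (≢-sym z≢q) (≢-sym z≢p)
  ... | inj₁ cw = gap₂ z z∈ (turn cw)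
  ... | inj₂ cw = gap₁ z z∈ cw

  -- No vertex lies between `a` and `next a`, so these would be consecutive in both directions.
  -- Hence no subgon lies on the outer face of a side of P_N.
  not-consecutive-next : IsSubgon D Q → ¬ Consecutive Q (next a) a
  not-consecutive-next {Q} {a} sub con@(p∈ , q∈ , p≢q , _) =
    not-two sub con (q∈ , p∈ , ≢-sym p≢q , λ x _ → cw-next)

  successor-before : IsSubgon D Q → Consecutive Q p q → Consecutive Q q s → Clockwise q s p
  successor-before {Q} {p} {q} {s} sub pq@(p∈ , _ , p≢q , gap-pq) qs@(_ , s∈ , q≢s , _)
    with cw-total {a = q} {s} {p} q≢s (λ { refl → not-two sub pq qs }) (≢-sym p≢q)
  ... | inj₁ cw = cw
  ... | inj₂ cw = contradiction (turn cw) (gap-pq s s∈)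

  -- Such an edge would leave the corner q into the interior of Q, with s and p on different sides.
  -- It is no side of P_N, since it has vertices on both sides. If it is a diagonal and a belongs to
  -- Q, it contradicts `uncut`; otherwise a lies behind a side u v of Q, which is then a diagonal
  -- crossing it.
  no-edge-through : IsSubgon D Q → Consecutive Q p q → Consecutive Q q s →
                    Clockwise s a p → ¬ Edge q a
  no-edge-through {Q} {p} {q} {s} {a} sub pq@(p∈ , q∈ , p≢q , gap-pq) qs@(_ , s∈ , q≢s , gap-qs) sap =
    λ { (inj₁ (inj₁ refl)) → cw-next q-s-a
      ; (inj₁ (inj₂ refl)) → cw-next a-p-q
      ; (inj₂ d) → through d }
    where
    q-s-p : Clockwise q s p
    q-s-p = successor-before sub pq qs
    q-s-a : Clockwise q s a
    q-s-a = turn (turn (cw-trans sap (turn q-s-p)))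
    a-p-q : Clockwise a p q
    a-p-q = cw-tail sap (turn q-s-p)
    through : ¬ D q a
    through d with a ∈? Q
    ... | yes a∈ with uncut sub q a q∈ a∈ d
    ...   | inj₁ (_ , _ , _ , g) = g s s∈ q-s-a
    ...   | inj₂ (_ , _ , _ , g) = g p p∈ a-p-q
    through d | no a∉ with gap a∉ p∈ q∈ p≢q
    ...   | u , v , uv@(u∈ , v∈ , u≢v , gap-uv) , uav with bounded sub u v uv
    ...     | inj₁ (inj₁ refl) = cw-next uav
    ...     | inj₁ (inj₂ refl) = not-consecutive-next sub uv
    ...     | inj₂ duv = noncrossing d duv (turn (turn (cw-trans uav u-v-q)) , cw-tail uav u-v-q)
      where
      u≢q : u ≢ q
      u≢q refl = gap-uv s s∈ (cw-trans q-s-a uav)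
      v≢q : v ≢ q
      v≢q refl = gap-uv p p∈ (turn (turn (cw-tail a-p-q (turn uav))))
      u-v-q : Clockwise u v q
      u-v-q with cw-total {a = u} {v} {q} u≢v v≢q u≢q
      ... | inj₁ cw = cw
      ... | inj₂ cw = contradiction cw (gap-uv q q∈)

  -- If the successors differed, the edge to the farther one would run through the interior of the
  -- subgon with the nearer one.
  successors-agree : IsSubgon D Q → IsSubgon D Q′ → Consecutive Q p q → Consecutive Q′ p q →
                     Consecutive Q q s → Consecutive Q′ q s
  successors-agree {Q} {Q′} {p} {q} {s} sub sub′ pq@(_ , _ , p≢q , _) pq′@(p∈′ , q∈′ , _ , _)
      qs@(_ , s∈ , q≢s , _)
    with successor q∈′ p∈′ p≢q
  ... | s′ , qs′@(_ , s∈′ , q≢s′ , _) with s ≟ᶠ s′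
  ... | yes refl = qs′
  ... | no s≢s′ with cw-total {a = q} {s} {s′} q≢s s≢s′ q≢s′
  ...   | inj₁ cw = contradiction (bounded sub′ q s′ qs′)
            (no-edge-through sub pq qs (cw-tail cw (successor-before sub′ pq′ qs′)))
  ...   | inj₂ cw = contradiction (bounded sub q s qs)
            (no-edge-through sub′ pq′ qs′ (cw-tail cw (successor-before sub pq qs)))

  subgon-⊆ : IsSubgon D Q → IsSubgon D Q′ → Consecutive Q p q → Consecutive Q′ p q → Q ⊆ Q′
  subgon-⊆ {Q} {Q′} {p} {q} sub sub′ pq@(p∈ , q∈ , p≢q , g) pq′@(_ , q∈′ , _ , _) {x} x∈ with x ≟ᶠ q
  ... | yes refl = q∈′
  ... | no x≢q = proj₁ (proj₂ (proj₂ (reach x (spo-wellFounded (cw-order q) x) x∈ x≢q)))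
    where
    -- Going around from q, the induction also carries the side that ends at x, in both subgons: the
    -- next application of `successors-agree` starts from it.
    reach : ∀ x → Acc (Clockwise q) x → x ∈ Q → x ≢ q → ∃[ y ] Consecutive Q y x × x ∈ Q′ × Consecutive Q′ y x
    reach x (acc rs) x∈ x≢q with predecessor x∈ q∈ (≢-sym x≢q)
    ... | y , yx@(y∈ , _ , y≢x , gap-yx) with y ≟ᶠ q
    ...   | yes refl = let c = successors-agree sub sub′ pq pq′ yx in y , yx , proj₁ (proj₂ c) , c
    ...   | no y≢q with cw-total {a = q} {y} {x} (≢-sym y≢q) y≢x (≢-sym x≢q)
    ...     | inj₂ cw = contradiction (turn (turn cw)) (gap-yx q q∈)
    ...     | inj₁ cw with reach y (rs cw) y∈ y≢q
    ...       | z , zy , _ , zy′ = let c = successors-agree sub sub′ zy zy′ yx in y , yx , proj₁ (proj₂ c) , c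

-- Existence of the subgon below an edge.

module _ {P : Pred (Fin M) 0ℓ} (P? : Decidable P) where

  subset : Subset M
  subset = Vec.tabulate (does ∘ P?)

  ∈-subset⁺ : ∀ {x} → P x → x ∈ subset
  ∈-subset⁺ {x} px = Vec.lookup⇒[]= x subset (trans (Vec.lookup∘tabulate _ x) (dec-true (P? x) px))

  ∈-subset⁻ : ∀ {x} → x ∈ subset → P x
  ∈-subset⁻ {x} x∈ with P? x | trans (sym (Vec.lookup∘tabulate (does ∘ P?) x)) (Vec.[]=⇒lookup x∈)
  ... | yes px | _ = px

cw-linear : {a b c : Fin M} → a Fin.< c → Clockwise a b c → a Fin.< b × b Fin.< c
cw-linear a<c (inj₁ p)              = p
cw-linear a<c (inj₂ (inj₁ (_ , p))) = contradiction p (Fin.<-asym a<c)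
cw-linear a<c (inj₂ (inj₂ (p , _))) = contradiction p (Fin.<-asym a<c)

cw-outside : {a b c : Fin M} → a Fin.< c → Clockwise c b a → c Fin.< b ⊎ b Fin.< a
cw-outside a<c (inj₁ (p , _))        = inj₁ p
cw-outside a<c (inj₂ (inj₁ (p , _))) = inj₂ p
cw-outside a<c (inj₂ (inj₂ (_ , p))) = inj₁ p

next-suc : {a b : Fin M} → a Fin.< b → toℕ (next a) ≡ suc (toℕ a)
next-suc {suc n} {a} {b} a<b with view a
... | ‵fromℕ     = contradiction a<b (fromℕ≮ b)
... | ‵inject₁ j = cong suc (sym (Fin.toℕ-inject₁ j))

module _ {D : Rel (Fin M) 0ℓ}
         (D? : Binary.Decidable D)
         (D-sym : Symmetric D)
         (diagonal : ∀ {a b} → D a b → a ≢ b)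
         (noncrossing : ∀ {a b c d} → D a b → D c d → ¬ Crossing a b c d) where

  noncrossing-< : ∀ {a b c d} → D a b → D c d → a Fin.< c → c Fin.< b → ¬ (b Fin.< d)
  noncrossing-< dab dcd a<c c<b b<d =
    noncrossing dab dcd (inj₁ (a<c , c<b) , inj₂ (inj₂ (Fin.<-trans a<c c<b , b<d)))

  module _ {x y : Fin M} (x<y : x Fin.< y) (edge : Edge noncrossing x y) where

    -- The diagonal (u , v) hides z from the base (x , y). The base is excluded because it may
    -- itself be a diagonal.
    Cut : Fin M → Rel (Fin M) 0ℓ
    Cut z u v = toℕ x ≤ toℕ u × toℕ v ≤ toℕ y × D u v × ¬ (u ≡ x × v ≡ y) × u Fin.< z × z Fin.< v

    cut? : ∀ z u v → Dec (Cut z u v)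
    cut? z u v = (toℕ x ≤? toℕ u) ×-dec (toℕ v ≤? toℕ y) ×-dec D? u v ×-dec
                 ¬? ((u ≟ᶠ x) ×-dec (v ≟ᶠ y)) ×-dec (u <ᶠ? z) ×-dec (z <ᶠ? v)

    Cut? : ∀ z → Dec (∃[ u ] ∃[ v ] Cut z u v)
    Cut? z = any? λ u → any? λ v → cut? z u v

    Visible : Pred (Fin M) 0ℓ
    Visible z = toℕ x ≤ toℕ z × toℕ z ≤ toℕ y × ¬ (∃[ u ] ∃[ v ] Cut z u v)

    visible? : Decidable Visible
    visible? z = (toℕ x ≤? toℕ z) ×-dec (toℕ z ≤? toℕ y) ×-dec ¬? (Cut? z)

    -- The subgon inside [x , y] with the side (x , y) consists of the vertices that no
    -- other diagonal inside [x , y] cuts off from this side.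
    below : Subset M
    below = subset visible?

    private
      x≤y : toℕ x ≤ toℕ y
      x≤y = <⇒≤ x<y

      x∈ : x ∈ below
      x∈ = ∈-subset⁺ visible? (≤-refl , x≤y , λ { (u , v , x≤u , _ , _ , _ , u<x , _) → <⇒≱ u<x x≤u })

      y∈ : y ∈ below
      y∈ = ∈-subset⁺ visible? (x≤y , ≤-refl , λ { (u , v , _ , v≤y , _ , _ , _ , y<v) → <⇒≱ y<v v≤y })

      x≤ : ∀ {z} → z ∈ below → toℕ x ≤ toℕ z
      x≤ z∈ = proj₁ (∈-subset⁻ visible? z∈)

      ≤y : ∀ {z} → z ∈ below → toℕ z ≤ toℕ y
      ≤y z∈ = proj₁ (proj₂ (∈-subset⁻ visible? z∈))

      uncovered : ∀ {z} → z ∈ below → ¬ (∃[ u ] ∃[ v ] Cut z u v)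
      uncovered z∈ = proj₂ (proj₂ (∈-subset⁻ visible? z∈))

    -- Take u leftmost and then v rightmost. A diagonal hiding u or v would cross (u , v) or hide z
    -- as well while reaching further out, against the choice.
    outermost : ∀ {z} → toℕ x ≤ toℕ z → toℕ z ≤ toℕ y → z ∉ below →
                ∃[ u ] ∃[ v ] Cut z u v × u ∈ below × v ∈ below
    outermost {z} x≤z z≤y z∉ with Cut? z
    ... | no none = contradiction (∈-subset⁺ visible? (x≤z , z≤y , none)) z∉
    ... | yes (_ , cuts) with minimal (λ u → any? (cut? z u)) _<ᶠ?_ <-wellFounded cuts
    ... | u , (_ , cut) , leftmost with minimal (cut? z u) (flip _<ᶠ?_) >-wellFounded cut
    ... | v , cut@(x≤u , v≤y , duv , _ , u<z , z<v) , rightmost = u , v , cut ,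
      ∈-subset⁺ visible? (x≤u , ≤-trans (<⇒≤ (<-trans u<z z<v)) v≤y , u-uncovered) ,
      ∈-subset⁺ visible? (≤-trans x≤u (<⇒≤ (<-trans u<z z<v)) , v≤y , v-uncovered)
      where
      u-uncovered : ¬ (∃[ u′ ] ∃[ v′ ] Cut u u′ v′)
      u-uncovered (u′ , v′ , x≤u′ , v′≤y , d′ , ne , u′<u , u<v′) with v′ <ᶠ? v
      ... | yes v′<v = noncrossing-< d′ duv u′<u u<v′ v′<v
      ... | no v′≮v  = leftmost u′
        (v′ , x≤u′ , v′≤y , d′ , ne , <-trans u′<u u<z , <-≤-trans z<v (≮⇒≥ v′≮v)) u′<u
      v-uncovered : ¬ (∃[ u′ ] ∃[ v′ ] Cut v u′ v′)
      v-uncovered (u′ , v′ , x≤u′ , v′≤y , d′ , ne , u′<v , v<v′) with Fin.<-cmp u u′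
      ... | tri< u<u′ _ _ = noncrossing-< duv d′ u<u′ u′<v v<v′
      ... | tri≈ _ refl _ = rightmost v′
        (x≤u′ , v′≤y , d′ , ne , u<z , <-trans z<v v<v′) v<v′
      ... | tri> _ _ u′<u = leftmost u′
        (v′ , x≤u′ , v′≤y , d′ , ne , <-trans u′<u u<z , <-trans z<v v<v′) u′<u

    below-consecutive : Consecutive below y x
    below-consecutive = y∈ , x∈ , (λ { refl → <-irrefl refl x<y }) , λ z z∈ cw →
      Sum.[ (λ y<z → <⇒≱ y<z (≤y z∈)) , (λ z<x → <⇒≱ z<x (x≤ z∈)) ] (cw-outside x<y cw)

    -- The vertex z provides a third corner: either z itself is visible, or an end of the outermost
    -- diagonal over z is a corner other than x and y.
    below-subgon : ∀ {z} → x Fin.< z → z Fin.< y → IsSubgon D below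
    below-subgon {z} x<z z<y = mkIsSubgon large bounded uncut
      where
      distinct : ∀ {a b : Fin M} → a Fin.< b → a ≢ b
      distinct a<b refl = <-irrefl refl a<b

      large : 3 ≤ ∣ below ∣
      large with z ∈? below
      ... | yes z∈ = three x∈ z∈ y∈ (distinct x<z) (distinct x<y) (distinct z<y)
      ... | no z∉ with outermost (<⇒≤ x<z) (<⇒≤ z<y) z∉
      ... | u , v , (_ , v≤y , _ , ne , u<z , z<v) , u∈ , v∈ with u ≟ᶠ x
      ...   | no u≢x   = three x∈ u∈ y∈ (≢-sym u≢x) (distinct x<y) (distinct (<-trans u<z z<y))
      ...   | yes refl = three x∈ v∈ y∈ (distinct (<-trans u<z z<v)) (distinct x<y) (λ v≡y → ne (refl , v≡y))

      bounded : ∀ a b → Consecutive below a b → Side a b ⊎ D a b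
      bounded a b (a∈ , b∈ , a≢b , gap-ab) with Fin.<-cmp a b
      ... | tri≈ _ eq _ = contradiction eq a≢b
      -- All of `below` lies between x and y, so a descending consecutive pair can only be the base
      -- (y , x).
      ... | tri> _ _ b<a = subst₂ (Edge noncrossing) y≡a x≡b (Sum.map swap D-sym edge)
        where
        x≡b : x ≡ b
        x≡b = toℕ-injective (≤-antisym (x≤ b∈) (≮⇒≥ λ x<b → gap-ab x x∈ (inj₂ (inj₁ (x<b , b<a)))))
        y≡a : y ≡ a
        y≡a = toℕ-injective (≤-antisym (≮⇒≥ λ a<y → gap-ab y y∈ (inj₂ (inj₂ (b<a , a<y)))) (≤y a∈))
      ... | tri< a<b _ _ with next a ≟ᶠ b
      ...   | yes eq = inj₁ (inj₁ (sym eq))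
      -- `next a` is hidden, and the outermost diagonal over it is (a , b): its visible ends do not
      -- lie strictly between a and b, and an end further out would hide a or b.
      ...   | no ne = inj₂ (cut-side (outermost (≤-trans (x≤ a∈) (<⇒≤ a<a⁺)) (≤-trans (<⇒≤ a⁺<b) (≤y b∈))
                       (λ a⁺∈ → gap-ab a⁺ a⁺∈ (inj₁ (a<a⁺ , a⁺<b)))))
        where
        a⁺ = next a
        a⁺≡ : toℕ a⁺ ≡ suc (toℕ a)
        a⁺≡ = next-suc a<b
        a<a⁺ : a Fin.< a⁺
        a<a⁺ = ≤-reflexive (sym a⁺≡)
        a⁺<b : a⁺ Fin.< b
        a⁺<b = ≤∧≢⇒< (subst (_≤ toℕ b) (sym a⁺≡) a<b) (ne ∘ toℕ-injective)
        cut-side : (∃[ u ] ∃[ v ] Cut a⁺ u v × u ∈ below × v ∈ below) → D a b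
        cut-side (u , v , (x≤u , v≤y , duv , not-xy , u<a⁺ , a⁺<v) , u∈ , v∈) = subst₂ D u≡a v≡b duv
          where
          u≤a : toℕ u ≤ toℕ a
          u≤a = ≤-pred (subst (λ k → suc (toℕ u) ≤ k) a⁺≡ u<a⁺)
          b≤v : toℕ b ≤ toℕ v
          b≤v = ≮⇒≥ λ v<b → gap-ab v v∈ (inj₁ (<-trans a<a⁺ a⁺<v , v<b))
          u≡a : u ≡ a
          u≡a = toℕ-injective (≤-antisym u≤a (≮⇒≥ λ u<a → uncovered a∈
            (u , v , x≤u , v≤y , duv , not-xy , u<a , <-≤-trans a<b b≤v)))
          v≡b : v ≡ b
          v≡b = toℕ-injective (≤-antisym (≮⇒≥ λ b<v → uncovered b∈
            (u , v , x≤u , v≤y , duv , not-xy , <-trans u<a⁺ a⁺<b , b<v)) b≤v)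

      uncut-< : ∀ a b → a ∈ below → b ∈ below → D a b → a Fin.< b →
                Consecutive below a b ⊎ Consecutive below b a
      uncut-< a b a∈ b∈ dab a<b with (a ≟ᶠ x) ×-dec (b ≟ᶠ y)
      ... | yes (refl , refl) = inj₂ below-consecutive
      ... | no not-xy = inj₁ (a∈ , b∈ , distinct a<b , λ z z∈ cw → let a<z , z<b = cw-linear a<b cw in
        uncovered z∈ (a , b , x≤ a∈ , ≤y b∈ , dab , not-xy , a<z , z<b))

      uncut : ∀ a b → a ∈ below → b ∈ below → D a b → Consecutive below a b ⊎ Consecutive below b a
      uncut a b a∈ b∈ dab with Fin.<-cmp a b
      ... | tri< a<b _ _ = uncut-< a b a∈ b∈ dab a<b
      ... | tri≈ _ eq _  = contradiction eq (diagonal dab)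
      ... | tri> _ _ b<a = swap (uncut-< b a b∈ a∈ (D-sym dab) b<a)

-- The sweep as a list of turns around indexed vertices.

-- Used for filtered lists of subgons: with at most one member, their order of enumeration does not
-- matter.
unique-≡ : ∀ {A : Set} {xs ys : List A} → Unique xs → Unique ys →
           (∀ {x y} → x List.∈ xs → y List.∈ xs → x ≡ y) →
           (∀ {x} → x List.∈ xs → x List.∈ ys) → (∀ {x} → x List.∈ ys → x List.∈ xs) → xs ≡ ys
unique-≡ {xs = []} {[]} _ _ eq f g = refl
unique-≡ {xs = []} {y ∷ ys} _ _ eq f g = contradiction (g (here refl)) λ ()
unique-≡ {xs = x ∷ []} {[]} _ _ eq f g = contradiction (f (here refl)) λ ()
unique-≡ {xs = x ∷ []} {y ∷ []} _ _ eq f g = cong [_] (eq (here refl) (g (here refl)))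
unique-≡ {xs = x ∷ []} {y ∷ y′ ∷ ys} _ ((y≢ ∷ _) ∷ _) eq f g =
  contradiction (eq (g (here refl)) (g (there (here refl)))) y≢
unique-≡ {xs = x ∷ x′ ∷ xs} ((x≢ ∷ _) ∷ _) _ eq f g = contradiction (eq (here refl) (there (here refl))) x≢

no-members : ∀ {A : Set} (xs : List A) → (∀ {x} → ¬ x List.∈ xs) → xs ≡ []
no-members []       none = refl
no-members (x ∷ xs) none = contradiction (here refl) none

∈-subsets : ∀ {N} (Q : Subset N) → Q List.∈ subsets N
∈-subsets [] = here refl
∈-subsets {suc N} (inside ∷ Q)  = ∈-++⁺ʳ (map (outside ∷_) (subsets N)) (∈-map⁺ (inside ∷_) (∈-subsets Q))
∈-subsets (outside ∷ Q) = ∈-++⁺ˡ (∈-map⁺ (outside ∷_) (∈-subsets Q))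

subsets-unique : ∀ N → Unique (subsets N)
subsets-unique zero    = [] ∷ []
subsets-unique (suc N) = Unique.++⁺ (Unique.map⁺ Vec.∷-injectiveʳ (subsets-unique N))
  (Unique.map⁺ Vec.∷-injectiveʳ (subsets-unique N))
  λ { (p , q) → disjoint (∈-map⁻ (outside ∷_) p) (∈-map⁻ (inside ∷_) q) }
  where
  disjoint : ∀ {Q : Subset (suc N)} → ∃[ P ] P List.∈ subsets N × Q ≡ outside ∷ P →
             ¬ (∃[ P ] P List.∈ subsets N × Q ≡ inside ∷ P)
  disjoint (_ , _ , refl) (_ , _ , ())

-- Vertices are indexed by natural numbers modulo N, so that the vertices met in one
-- turn around vtx i have the indices strictly between i and i + N.
vtx : ∀ {n} → ℕ → Fin (suc n)
vtx zero    = zero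
vtx (suc k) = next (vtx k)

module _ {n : ℕ} where

  private
    N = suc n

  toℕ-vtx : ∀ {k} → k < N → toℕ (vtx {n} k) ≡ k
  toℕ-vtx {zero}  k<N = refl
  toℕ-vtx {suc k} (s≤s k<n) = trans
    (next-suc {b = fromℕ n} (subst₂ _<_ (sym ih) (sym (toℕ-fromℕ n)) k<n)) (cong suc ih)
    where
    ih : toℕ (vtx {n} k) ≡ k
    ih = toℕ-vtx (m≤n⇒m≤1+n k<n)

  vtx-toℕ : ∀ (i : Fin N) → vtx (toℕ i) ≡ i
  vtx-toℕ i = toℕ-injective (toℕ-vtx (toℕ<n i))

  vtx-injective : ∀ {i j} → i < N → j < N → vtx {n} i ≡ vtx j → i ≡ j
  vtx-injective i< j< eq = trans (sym (toℕ-vtx i<)) (trans (cong toℕ eq) (toℕ-vtx j<))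

  vtx-period : ∀ k → vtx {n} (k + N) ≡ vtx k
  vtx-period zero    = trans (cong next (toℕ-injective (trans (toℕ-vtx ≤-refl) (sym (toℕ-fromℕ n))))) (next-fromℕ n)
  vtx-period (suc k) = cong next (vtx-period k)

  vtx-clockwise : ∀ {a b c} → a < b → b < c → c < a + N → Clockwise (vtx {n} a) (vtx b) (vtx c)
  vtx-clockwise {zero} {b} {c} a<b b<c c<N = inj₁
    (subst₂ _<_ (sym (toℕ-vtx {0} (s≤s z≤n))) (sym b≡) a<b , subst₂ _<_ (sym b≡) (sym (toℕ-vtx c<N)) b<c)
    where
    b≡ : toℕ (vtx {n} b) ≡ b
    b≡ = toℕ-vtx (<-trans b<c c<N)
  vtx-clockwise {suc a} {suc b} {suc c} (s≤s p) (s≤s q) (s≤s r) = clockwise-next (vtx-clockwise p q r)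

  module _ {A : Set} (f : Fin N → Fin N → List A) where

    -- The part of the turn around vtx i that goes from vtx (i + j) down to vtx (i + 1).
    turnAt : ℕ → ℕ → List A
    turnAt i zero    = []
    turnAt i (suc j) = f (vtx (i + suc j)) (vtx i) ++ turnAt i j

    -- Each complete turn has n = N - 1 positions: it starts at index i + n, which is the vertex
    -- before vtx i.
    turns : ℕ → ℕ → List A
    turns i zero    = []
    turns i (suc c) = turnAt i n ++ turns (suc i) c

    turnAt-iterate : ∀ i j → concatMap (λ a → f a (vtx i)) (iterate prev (vtx (i + j)) j) ≡ turnAt i j
    turnAt-iterate i zero    = refl
    turnAt-iterate i (suc j) = cong (f (vtx (i + suc j)) (vtx i) ++_) (trans
      (cong (λ a → concatMap (λ a → f a (vtx i)) (iterate prev a j))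
        (trans (cong (λ k → prev (vtx k)) (+-suc i j)) (prev-next (vtx (i + j)))))
      (turnAt-iterate i j))

    turnAt-full : ∀ i → concatMap (λ a → f a (vtx i)) (iterate prev (prev (vtx i)) n) ≡ turnAt i n
    turnAt-full i = trans
      (cong (λ a → concatMap (λ a → f a (vtx i)) (iterate prev a n))
        (trans (cong prev (trans (sym (vtx-period i)) (cong vtx (+-suc i n)))) (prev-next (vtx (i + n)))))
      (turnAt-iterate i n)

    turns-tabulate : ∀ i c (g : Fin c → Fin N) → (∀ j → g j ≡ vtx (i + toℕ j)) →
      concatMap (λ v → concatMap (λ a → f a v) (iterate prev (prev v) n)) (tabulate g) ≡ turns i c
    turns-tabulate i zero    g g≡ = refl
    turns-tabulate i (suc c) g g≡ = cong₂ _++_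
      (trans (cong (λ v → concatMap (λ a → f a v) (iterate prev (prev v) n))
               (trans (g≡ zero) (cong vtx (+-identityʳ i)))) (turnAt-full i))
      (turns-tabulate (suc i) c (g ∘ suc) (λ j → trans (g≡ (suc j)) (cong vtx (+-suc i (toℕ j)))))

    turnAt-skip : ∀ i {j j′} → j ≤ j′ → (∀ k → j < k → k ≤ j′ → f (vtx (i + k)) (vtx i) ≡ []) →
                  turnAt i j′ ≡ turnAt i j
    turnAt-skip i {j} {zero} z≤n none = refl
    turnAt-skip i {j} {suc j′} j≤ none with m≤n⇒m<n∨m≡n j≤
    ... | inj₂ refl = refl
    ... | inj₁ (s≤s j≤j′) = trans (cong (_++ turnAt i j′) (none (suc j′) (s≤s j≤j′) ≤-refl))
      (turnAt-skip i j≤j′ (λ k j<k k≤ → none k j<k (m≤n⇒m≤1+n k≤)))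

    turns-snoc : ∀ i c → turns i (suc c) ≡ turns i c ++ turnAt (c + i) n
    turns-snoc i zero    = ++-identityʳ _
    turns-snoc i (suc c) = trans (cong (turnAt i n ++_) (trans (turns-snoc (suc i) c)
      (cong (λ k → turns (suc i) c ++ turnAt k n) (+-suc c i)))) (sym (++-assoc (turnAt i n) _ _))

    turnAt-period : ∀ j → turnAt N j ≡ turnAt 0 j
    turnAt-period zero    = refl
    turnAt-period (suc j) = cong₂ _++_
      (cong₂ f (trans (cong vtx (+-comm N (suc j))) (vtx-period (suc j))) (vtx-period 0)) (turnAt-period j)

-- The sweep follows the tree.

module Sweep {m n : ℕ} (T : Angulation m (suc n)) where
  open Angulation T
  open IsSubgon

  N : ℕ
  N = suc n

  Subgon : Subset N → Set
  Subgon = IsSubgon Diag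

  opaque

    -- Outside this opaque block `at` is known only by the facts proved in it, so the enumeration of
    -- all subsets does not unfold.
    at : Fin N → Fin N → List (Subset N)
    at a i = filter (λ Q → consecutive? Q a i) (subgons T)

    brow-turns : brow T ≡ transcribe m [] (turns at 0 N)
    brow-turns = cong (transcribe m []) (turns-tabulate at 0 N id (λ j → sym (vtx-toℕ j)))

    ∈-at⁺ : ∀ {Q a i} → Subgon Q → Consecutive Q a i → Q List.∈ at a i
    ∈-at⁺ sub con = ∈-filter⁺ (λ Q → consecutive? Q _ _) (∈-filter⁺ (isSubgon? diag?) (∈-subsets _) sub) con

    ∈-at⁻ : ∀ {Q a i} → Q List.∈ at a i → Subgon Q × Consecutive Q a i
    ∈-at⁻ Q∈ = let Q∈subgons , con = ∈-filter⁻ (λ Q → consecutive? Q _ _) {xs = subgons T} Q∈ in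
      proj₂ (∈-filter⁻ (isSubgon? diag?) {xs = subsets N} Q∈subgons) , con

    at-unique : ∀ {a i} → Unique (at a i)
    at-unique = Unique.filter⁺ (λ Q → consecutive? Q _ _) (Unique.filter⁺ (isSubgon? diag?) (subsets-unique N))

  at-subsingleton : ∀ {a i Q Q′} → Q List.∈ at a i → Q′ List.∈ at a i → Q ≡ Q′
  at-subsingleton Q∈ Q∈′ with ∈-at⁻ Q∈ | ∈-at⁻ Q∈′
  ... | sub , con | sub′ , con′ =
    ⊆-antisym (subgon-⊆ noncrossing sub sub′ con con′) (subgon-⊆ noncrossing sub′ sub con′ con)

  at-single : ∀ {Q a i} → Subgon Q → Consecutive Q a i → at a i ≡ [ Q ]
  at-single sub con = unique-≡ at-unique ([] ∷ []) at-subsingleton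
    (λ Q∈ → here (at-subsingleton Q∈ (∈-at⁺ sub con))) (λ { (here refl) → ∈-at⁺ sub con })

  at-next : ∀ i → at (next i) i ≡ []
  at-next i = no-members _ λ Q∈ → let sub , con = ∈-at⁻ Q∈ in not-consecutive-next noncrossing sub con

  at-through : ∀ {Q p q s a} → Subgon Q → Consecutive Q p q → Consecutive Q q s → Clockwise s a p → at a q ≡ []
  at-through sub pq qs sap = no-members _ λ Q∈ → let sub′ , aq = ∈-at⁻ Q∈ in
    no-edge-through noncrossing sub pq qs sap
      (Sum.map swap diag-sym (bounded sub′ _ _ aq))

  mutual

    -- t describes the part of T with indices from x to y. Clockwise from vtx y one wraps around to
    -- vtx x, so `Consecutive Q (vtx y) (vtx x)` places Q on this side of the edge; the forest hangs
    -- on the remaining sides of Q, from x up to y.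
    data Fits : ℕ → ℕ → Tree m N → Set where
      leaf : ∀ {x} → Fits x (suc x) leaf
      node : ∀ {x y Q t ts} → Subgon Q → Consecutive Q (vtx y) (vtx x) → FitsF Q x y (t ∷ ts) →
             Fits x y (node Q t ts)

    data FitsF (Q : Subset N) : ∀ {j} → ℕ → ℕ → Forest m N j → Set where
      []  : ∀ {y} → FitsF Q y y []
      _∷_ : ∀ {u v y t j} {ts : Forest m N j} → Consecutive Q (vtx u) (vtx v) × Fits u v t →
            FitsF Q v y ts → FitsF Q u y (t ∷ ts)

  mutual

    fits-< : ∀ {x y t} → Fits x y t → x < y
    fits-< leaf                      = ≤-refl
    fits-< (node _ _ ((_ , ft) ∷ fts)) = <-≤-trans (fits-< ft) (fitsF-≤ fts)

    fitsF-≤ : ∀ {Q u y j} {ts : Forest m N j} → FitsF Q u y ts → u ≤ y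
    fitsF-≤ []               = ≤-refl
    fitsF-≤ ((_ , ft) ∷ fts) = ≤-trans (<⇒≤ (fits-< ft)) (fitsF-≤ fts)

  mutual

    -- A part with s subgons spans ms + 1 sides of P_N, as each subgon replaces one edge by m + 1
    -- edges.
    fits-size : ∀ {x y t} → Fits x y t → y ≡ suc (m * size t) + x
    fits-size {x} leaf = cong (λ k → suc (k + x)) (sym (*-zeroʳ m))
    fits-size {x} {y} {node Q t ts} (node _ _ fts) = begin
      y                                             ≡⟨ fitsF-size fts ⟩
      suc (m + m * (size t + sizeF ts)) + x         ≡⟨ cong (λ k → suc k + x) (*-suc m _) ⟨
      suc (m * suc (size t + sizeF ts)) + x         ∎
      where open ≡-Reasoning

    fitsF-size : ∀ {Q u y j} {ts : Forest m N j} → FitsF Q u y ts → y ≡ j + m * sizeF ts + u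
    fitsF-size {u = u} [] = cong (_+ u) (sym (*-zeroʳ m))
    fitsF-size {u = u} {y} {suc j} {t ∷ ts} ((_ , ft) ∷ fts) = begin
      y                                                 ≡⟨ fitsF-size fts ⟩
      j + m * sizeF ts + _                              ≡⟨ cong (λ k → j + m * sizeF ts + k) (fits-size ft) ⟩
      j + m * sizeF ts + (suc (m * size t) + u)         ≡⟨ +-assoc (j + m * sizeF ts) (suc (m * size t)) u ⟨
      j + m * sizeF ts + suc (m * size t) + u           ≡⟨ cong (_+ u) (+-suc (j + m * sizeF ts) (m * size t)) ⟩
      suc (j + m * sizeF ts + m * size t) + u           ≡⟨ cong (λ k → suc k + u) (+-assoc j _ _) ⟩
      suc (j + (m * sizeF ts + m * size t)) + u         ≡⟨ cong (λ k → suc (j + k) + u) (+-comm (m * sizeF ts) _) ⟩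
      suc (j + (m * size t + m * sizeF ts)) + u         ≡⟨ cong (λ k → suc (j + k) + u) (*-distribˡ-+ m (size t) (sizeF ts)) ⟨
      suc (j + m * (size t + sizeF ts)) + u             ∎
      where open ≡-Reasoning

  module _ {Q : Subset N} where

    -- Q fills the angle at vtx u between p and s, so after Q nothing is met before the ray reaches
    -- s.
    turn-start : ∀ {u j e p s} → Subgon Q → Consecutive Q p (vtx u) → vtx (u + e) ≡ p →
      Consecutive Q (vtx u) s → vtx (u + j) ≡ s → j < e → e < N →
      turnAt at u e ≡ Q ∷ turnAt at u j
    turn-start {u} {j} {suc e} sub pu refl us refl (s≤s j≤e) e<N = cong₂ _++_ (at-single sub pu)
      (turnAt-skip at u j≤e λ k j<k k≤e → at-through sub pu us
        (vtx-clockwise (+-monoʳ-< u j<k) (+-monoʳ-< u (s≤s k≤e))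
          (<-≤-trans (+-monoʳ-< u e<N) (+-monoˡ-≤ N (m≤m+n u j)))))

    not-whole : ∀ {x y v} → Subgon Q → Consecutive Q (vtx y) (vtx x) → Consecutive Q (vtx x) (vtx v) → v ≢ y
    not-whole sub yx xv refl = not-two noncrossing sub xv yx

    node-start : ∀ {x y v d d₁} → Subgon Q → Consecutive Q (vtx y) (vtx x) → Consecutive Q (vtx x) (vtx v) →
      v ≤ y → y < N → y ≡ x + d → v ≡ x + d₁ → turnAt at x d ≡ Q ∷ turnAt at x d₁
    node-start {x} {y} {v} {d} sub yx xv v≤y y<N refl refl = turn-start sub yx refl xv refl
      (+-cancelˡ-< x _ d (≤∧≢⇒< v≤y (not-whole {x} {y} {v} sub yx xv))) (≤-<-trans (m≤n+m d x) y<N)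

  -- The sweep from the position (i , i + j) on, up to the end of the turn around vtx (i + c).
  rest : ℕ → ℕ → ℕ → List (Subset N)
  rest i j c = turnAt at i j ++ turns at (suc i) c

  step : ∀ {u v} → u ≤ v → ∃[ d ] v ≡ u + d
  step u≤v = let d , eq = m≤n⇒∃[o]m+o≡n u≤v in d , sym eq

  mutual

    -- At the start the ray points from vtx x to vtx y. When the visits of t are done it points from
    -- vtx y back to vtx x, whose index is now y + e = x + N, and is about to cross the edge. After
    -- the rest of that turn, c complete turns remain.
    rest-visits : ∀ {x y t d e c} → Fits x y t → y < N → y ≡ x + d → d + e ≡ N →
                  rest x d (d + c) ≡ visits t ++ rest y e c
    rest-visits {x} {d = d} {c = c} leaf y<N y≡ d+e≡ with +-cancelˡ-≡ x 1 d (trans (+-comm x 1) y≡)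
    rest-visits {x} {c = c} leaf y<N y≡ refl | refl = cong (_++ turns at (suc x) (suc c))
      (trans (++-identityʳ _) (trans (cong (λ k → at (vtx k) (vtx x)) (+-comm x 1)) (at-next (vtx x))))
    rest-visits {x} {y} {node Q t ts} {d} {e} {c} (node sub yx ((xv , ft) ∷ fts)) y<N y≡ d+e≡
      with step (<⇒≤ (fits-< ft)) | step (fitsF-≤ fts)
    ... | d₁ , refl | r , v+r≡ = begin
        turnAt at x d ++ turns at (suc x) (d + c)
      ≡⟨ cong₂ (λ a k → a ++ turns at (suc x) k)
           (node-start {Q} {x} {y} {x + d₁} sub yx xv (fitsF-≤ fts) y<N y≡ refl) d+c≡ ⟩
        Q ∷ rest x d₁ (d₁ + (r + c))
      ≡⟨ cong (Q ∷_) (rest-visits ft (≤-<-trans (fitsF-≤ fts) y<N) refl d₁+e₁≡) ⟩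
        Q ∷ visits t ++ rest (x + d₁) (r + e) (r + c)
      ≡⟨ cong (λ z → Q ∷ visits t ++ z)
           (rest-visitsF fts y<N sub yx xv ≤-refl (fits-< ft) refl d₁+e₁≡ v+r≡ y≡ d+e≡) ⟩
        Q ∷ visits t ++ visitsF Q ts ++ rest y e c
      ≡⟨ cong (Q ∷_) (++-assoc (visits t) _ _) ⟨
        Q ∷ (visits t ++ visitsF Q ts) ++ rest y e c
      ∎
      where
      open ≡-Reasoning
      d≡ : d ≡ d₁ + r
      d≡ = +-cancelˡ-≡ x d (d₁ + r) (trans (sym y≡) (trans v+r≡ (+-assoc x d₁ r)))
      d+c≡ : d + c ≡ d₁ + (r + c)
      d+c≡ = trans (cong (_+ c) d≡) (+-assoc d₁ r c)
      d₁+e₁≡ : d₁ + (r + e) ≡ N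
      d₁+e₁≡ = trans (sym (+-assoc d₁ r e)) (trans (cong (_+ e) (sym d≡)) d+e≡)

    -- The sweep has just finished the subtree over the side (p , u) of Q: the ray points from vtx u
    -- back to vtx p, at index u + e₁ = p + N.
    rest-visitsF : ∀ {Q x p u y j} {ts : Forest m N j} {b e₁ r d e c} → FitsF Q u y ts → y < N → Subgon Q →
      Consecutive Q (vtx y) (vtx x) → Consecutive Q (vtx p) (vtx u) → x ≤ p → p < u →
      u ≡ p + b → b + e₁ ≡ N → y ≡ u + r → y ≡ x + d → d + e ≡ N →
      rest u e₁ (r + c) ≡ visitsF Q ts ++ rest y e c
    rest-visitsF {Q} {x} {p} {u} {b = b} {e₁} {r} {d} {e} {c} [] y<N sub yx pu x≤p p<u u≡ b+e₁≡ y≡ x+d≡ d+e≡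
      with +-cancelˡ-≡ u 0 r (trans (+-identityʳ u) y≡)
    -- At the last corner the angle of Q runs from p to x. That e < e₁ comes from x < p: if p were
    -- x, then Q would have only two vertices.
    ... | refl = cong (_++ turns at (suc u) c)
      (turn-start sub pu (trans (cong vtx u+e₁≡) (vtx-period p)) yx (trans (cong vtx u+e≡) (vtx-period x))
        (+-cancelˡ-< u e e₁ (subst₂ _<_ (sym u+e≡) (sym u+e₁≡) (+-monoˡ-< N x<p)))
        (+-cancelˡ-< p e₁ N (subst (p + e₁ <_) u+e₁≡ (+-monoˡ-< e₁ p<u))))
      where
      x<p : x < p
      x<p = ≤∧≢⇒< x≤p λ { refl → not-two noncrossing sub yx pu }
      u+e₁≡ : u + e₁ ≡ p + N
      u+e₁≡ = trans (cong (_+ e₁) u≡) (trans (+-assoc p b e₁) (cong (p +_) b+e₁≡))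
      u+e≡ : u + e ≡ x + N
      u+e≡ = trans (cong (_+ e) x+d≡) (trans (+-assoc x d e) (cong (x +_) d+e≡))
    rest-visitsF {Q} {x} {p} {u} {y} {ts = t ∷ ts} {b} {e₁} {r} {d} {e} {c} ((uv , ft) ∷ fts)
      y<N sub yx pu x≤p p<u u≡ b+e₁≡ y≡ x+d≡ d+e≡
      with step (<⇒≤ (fits-< ft)) | step (fitsF-≤ fts)
    ... | d₁ , refl | r′ , v+r′≡ with step {d₁} {N} (≤-trans (m≤n+m d₁ u) (≤-trans (fitsF-≤ fts) (<⇒≤ y<N)))
    ... | e₂ , N≡ = begin
        turnAt at u e₁ ++ turns at (suc u) (r + c)
      ≡⟨ cong₂ (λ a k → a ++ turns at (suc u) k)
           (turn-start sub pu (trans (cong vtx u+e₁≡) (vtx-period p)) uv refl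
             (+-cancelˡ-< u d₁ e₁ (≤-<-trans (fitsF-≤ fts)
               (subst (y <_) (sym u+e₁≡) (<-≤-trans y<N (m≤n+m N p)))))
             (+-cancelˡ-< p e₁ N (subst (p + e₁ <_) u+e₁≡ (+-monoˡ-< e₁ p<u))))
           (trans (cong (_+ c) r≡) (+-assoc d₁ r′ c)) ⟩
        Q ∷ rest u d₁ (d₁ + (r′ + c))
      ≡⟨ cong (Q ∷_) (rest-visits ft (≤-<-trans (fitsF-≤ fts) y<N) refl (sym N≡)) ⟩
        Q ∷ visits t ++ rest (u + d₁) e₂ (r′ + c)
      ≡⟨ cong (λ z → Q ∷ visits t ++ z)
           (rest-visitsF fts y<N sub yx uv (≤-trans x≤p (<⇒≤ p<u)) (fits-< ft) refl (sym N≡)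
             v+r′≡ x+d≡ d+e≡) ⟩
        Q ∷ visits t ++ visitsF Q ts ++ rest y e c
      ≡⟨ cong (Q ∷_) (++-assoc (visits t) _ _) ⟨
        Q ∷ (visits t ++ visitsF Q ts) ++ rest y e c
      ∎
      where
      open ≡-Reasoning
      u+e₁≡ : u + e₁ ≡ p + N
      u+e₁≡ = trans (cong (_+ e₁) u≡) (trans (+-assoc p b e₁) (cong (p +_) b+e₁≡))
      r≡ : r ≡ d₁ + r′
      r≡ = +-cancelˡ-≡ u r (d₁ + r′) (trans (sym y≡) (trans v+r′≡ (+-assoc u d₁ r′)))

  turnAt-spine : ∀ {x y t d} → Fits x y t → y < N → y ≡ x + d → turnAt at x d ≡ spine t
  turnAt-spine {x} {d = d} leaf y<N y≡ with +-cancelˡ-≡ x 1 d (trans (+-comm x 1) y≡)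
  ... | refl = trans (++-identityʳ _)
    (trans (cong (λ k → at (vtx k) (vtx x)) (+-comm x 1)) (at-next (vtx x)))
  turnAt-spine {x} {y} (node {Q = Q} sub yx ((xv , ft) ∷ fts)) y<N y≡ with step (<⇒≤ (fits-< ft))
  ... | d₁ , refl = trans (node-start {Q} {x} {y} {x + d₁} sub yx xv (fitsF-≤ fts) y<N y≡ refl)
    (cong (Q ∷_) (turnAt-spine ft (≤-<-trans (fitsF-≤ fts) y<N) refl))

  -- Distinct nodes carry distinct subgons.

  Within : ℕ → ℕ → Subset N → Set
  Within x y S = ∀ {z} → z ∈ S → x ≤ toℕ z × toℕ z ≤ y

  within-mono : ∀ {x x′ y y′ S} → x ≤ x′ → y′ ≤ y → Within x′ y′ S → Within x y S
  within-mono x≤ ≤y inS z∈ = let lo , hi = inS z∈ in ≤-trans x≤ lo , ≤-trans hi ≤y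

  within-side : ∀ {Q x y} → x < y → y < N → Consecutive Q (vtx y) (vtx x) → Within x y Q
  within-side {Q} {x} {y} x<y y<N (y∈ , x∈ , _ , gap) {z} z∈ =
    ≮⇒≥ (λ z<x → gap z z∈ (inj₂ (inj₁ (subst (toℕ z <_) (sym x≡) z<x , x<y′)))) ,
    ≮⇒≥ (λ y<z → gap z z∈ (inj₂ (inj₂ (x<y′ , subst (_< toℕ z) (sym y≡) y<z))))
    where
    x≡ : toℕ (vtx x) ≡ x
    x≡ = toℕ-vtx (<-trans x<y y<N)
    y≡ : toℕ (vtx y) ≡ y
    y≡ = toℕ-vtx y<N
    x<y′ : vtx x Fin.< vtx y
    x<y′ = subst₂ _<_ (sym x≡) (sym y≡) x<y

  -- The two intervals share only the index y, while a subgon has a vertex other than vtx y.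
  within-disjoint : ∀ {x y z S} → Subgon S → Within x y S → Within y z S → y < N → ∀ {A : Set} → A
  within-disjoint {y = y} sub in₁ in₂ y<N with third (nondegenerate sub) (vtx y) (vtx y)
  ... | z , z∈ , z≢ , _ = contradiction
    (toℕ-injective (trans (≤-antisym (proj₂ (in₁ z∈)) (proj₁ (in₂ z∈))) (sym (toℕ-vtx y<N)))) z≢

  mutual

    labels-within : ∀ {x y t} → Fits x y t → y < N → ∀ {S} → S List.∈ labels t → Subgon S × Within x y S
    labels-within f@(node sub yx fts) y<N (here refl) = sub , within-side (fits-< f) y<N yx
    labels-within (node sub yx fts) y<N (there S∈) = labelsF-within fts y<N S∈

    labelsF-within : ∀ {Q u y j} {ts : Forest m N j} → FitsF Q u y ts → y < N →
                     ∀ {S} → S List.∈ labelsF ts → Subgon S × Within u y S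
    labelsF-within {ts = t ∷ ts} ((uv , ft) ∷ fts) y<N S∈ with ∈-++⁻ (labels t) S∈
    ... | inj₁ S∈t  = let sub , inS = labels-within ft (≤-<-trans (fitsF-≤ fts) y<N) S∈t in
      sub , within-mono ≤-refl (fitsF-≤ fts) inS
    ... | inj₂ S∈ts = let sub , inS = labelsF-within fts y<N S∈ts in
      sub , within-mono (<⇒≤ (fits-< ft)) ≤-refl inS

  mutual

    labels-unique : ∀ {x y t} → Fits x y t → y < N → Unique (labels t)
    labels-unique leaf y<N = []
    labels-unique {x} {y} {node Q t ts} f@(node sub yx fts@(_∷_ {v = v} (xv , ft) fts′)) y<N =
      All.tabulate (λ { S∈ refl → Q∉ S∈ }) ∷ labelsF-unique fts y<N
      where
      Q∉ : ¬ Q List.∈ labels t ++ labelsF ts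
      -- vtx y belongs to Q but lies above the interval of t, and vtx x belongs to Q but lies below
      -- the interval of ts.
      Q∉ S∈ with ∈-++⁻ (labels t) S∈
      ... | inj₁ S∈t = <⇒≱ (≤∧≢⇒< (fitsF-≤ fts′) (not-whole {Q} {x} {y} {v} sub yx xv))
        (subst (_≤ _) (toℕ-vtx y<N)
          (proj₂ (proj₂ (labels-within ft (≤-<-trans (fitsF-≤ fts′) y<N) S∈t) (proj₁ yx))))
      ... | inj₂ S∈ts = <⇒≱ (fits-< ft)
        (subst (_ ≤_) (toℕ-vtx (<-trans (fits-< f) y<N))
          (proj₁ (proj₂ (labelsF-within fts′ y<N S∈ts) (proj₁ (proj₂ yx)))))

    labelsF-unique : ∀ {Q u y j} {ts : Forest m N j} → FitsF Q u y ts → y < N → Unique (labelsF ts)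
    labelsF-unique [] y<N = []
    labelsF-unique ((uv , ft) ∷ fts) y<N = Unique.++⁺ (labels-unique ft v<N) (labelsF-unique fts y<N)
      λ { (S∈t , S∈ts) → let sub , inS = labels-within ft v<N S∈t in
          within-disjoint sub inS (proj₂ (labelsF-within fts y<N S∈ts)) v<N }
      where v<N = ≤-<-trans (fitsF-≤ fts) y<N

  -- Construction of the tree.

  corners : ∀ {Q u y j} {ts : Forest m N j} → FitsF Q u y ts → List (Fin N)
  corners {u = u} []        = [ vtx u ]
  corners {u = u} (_ ∷ fts) = vtx u ∷ corners fts

  length-corners : ∀ {Q u y j} {ts : Forest m N j} (fts : FitsF Q u y ts) → length (corners fts) ≡ suc j
  length-corners []        = refl
  length-corners (_ ∷ fts) = cong suc (length-corners fts)

  corners-≥ : ∀ {Q u y j} {ts : Forest m N j} (fts : FitsF Q u y ts) → y < N → All (λ z → u ≤ toℕ z) (corners fts)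
  corners-≥ []                y<N = ≤-reflexive (sym (toℕ-vtx y<N)) ∷ []
  corners-≥ ((_ , ft) ∷ fts)  y<N =
    ≤-reflexive (sym (toℕ-vtx (<-trans (fits-< ft) (≤-<-trans (fitsF-≤ fts) y<N)))) ∷
    All.map (≤-trans (<⇒≤ (fits-< ft))) (corners-≥ fts y<N)

  corners-unique : ∀ {Q u y j} {ts : Forest m N j} (fts : FitsF Q u y ts) → y < N → Unique (corners fts)
  corners-unique []                        y<N = [] ∷ []
  corners-unique (_∷_ {v = v} (_ , ft) fts) y<N =
    All.map (λ { v≤ refl → <⇒≱ (fits-< ft)
        (subst (v ≤_) (toℕ-vtx (<-trans (fits-< ft) (≤-<-trans (fitsF-≤ fts) y<N))) v≤) })
      (corners-≥ fts y<N) ∷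
    corners-unique fts y<N

  corners-sound : ∀ {Q u y j} {ts : Forest m N j} (fts : FitsF Q u y ts) → vtx y ∈ Q → All (_∈ Q) (corners fts)
  corners-sound []                       y∈ = y∈ ∷ []
  corners-sound (((u∈ , _) , _) ∷ fts)   y∈ = u∈ ∷ corners-sound fts y∈

  corners-cover : ∀ {Q u y j} {ts : Forest m N j} (fts : FitsF Q u y ts) → y < N →
                  ∀ {z} → z ∈ Q → u ≤ toℕ z → toℕ z ≤ y → z List.∈ corners fts
  corners-cover [] y<N z∈ u≤z z≤y = here (toℕ-injective (trans (≤-antisym z≤y u≤z) (sym (toℕ-vtx y<N))))
  corners-cover (_∷_ {u} {v} ((_ , _ , _ , gap) , ft) fts) y<N {z} z∈ u≤z z≤y with m≤n⇒m<n∨m≡n u≤z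
  ... | inj₂ refl = here (sym (vtx-toℕ z))
  ... | inj₁ u<z = there (corners-cover fts y<N z∈ (≮⇒≥ λ z<v → gap z z∈
    (inj₁ (subst (_< toℕ z) (sym (toℕ-vtx (<-trans u<z (toℕ<n z)))) u<z ,
           subst (toℕ z <_) (sym (toℕ-vtx (≤-<-trans (fitsF-≤ fts) y<N))) z<v))) z≤y)

  -- The j sides other than the base run through j + 1 corners, and these are all m + 2 vertices of
  -- Q.
  forest-size : ∀ {Q x y j} {ts : Forest m N j} → FitsF Q x y ts → x < y → y < N → Subgon Q →
                Consecutive Q (vtx y) (vtx x) → j ≡ suc m
  forest-size {Q} {j = j} fts x<y y<N sub yx = suc-injective (begin
    suc j                 ≡⟨ length-corners fts ⟨
    length (corners fts)  ≡⟨ length-elements (corners fts) Q (corners-unique fts y<N)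
                               (λ z∈ → let lo , hi = within-side x<y y<N yx z∈ in
                                 corners-cover fts y<N z∈ lo hi)
                               (corners-sound fts (proj₁ yx)) ⟩
    ∣ Q ∣                 ≡⟨ subgon-size Q sub ⟩
    m + 2                 ≡⟨ +-comm m 2 ⟩
    suc (suc m)           ∎)
    where open ≡-Reasoning

  next-corner : ∀ {Q u y} → vtx u ∈ Q → vtx y ∈ Q → u < y → y < N →
                ∃[ v ] u < v × v ≤ y × Consecutive Q (vtx u) (vtx v)
  next-corner {Q} {u} {y} u∈ y∈ u<y y<N
    with successor u∈ y∈ (λ eq → <⇒≢ u<y (sym (vtx-injective y<N u<N eq)))
    where u<N = <-trans u<y y<N
  ... | z , uz@(_ , z∈ , u≢z , gap) = toℕ z ,
      ≤∧≢⇒< (≮⇒≥ (λ z<u → gap (vtx y) y∈ (inj₂ (inj₂ (subst (toℕ z <_) (sym u≡) z<u , u<y′)))))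
        (λ { refl → u≢z (vtx-toℕ z) }) ,
      ≮⇒≥ (λ y<z → gap (vtx y) y∈ (inj₁ (u<y′ , subst (_< toℕ z) (sym (toℕ-vtx y<N)) y<z))) ,
      subst (Consecutive Q (vtx u)) (sym (vtx-toℕ z)) uz
    where
    u≡ : toℕ (vtx u) ≡ u
    u≡ = toℕ-vtx (<-trans u<y y<N)
    u<y′ : vtx u Fin.< vtx y
    u<y′ = subst₂ _<_ (sym u≡) (sym (toℕ-vtx y<N)) u<y

  -- The number of trees is left open here; counting corners afterwards shows that it is m + 1.
  build-forest : ∀ fuel {Q u y} → y ≤ fuel + u → u ≤ y → y < N → vtx u ∈ Q → vtx y ∈ Q →
    (∀ {v w} → u ≤ v → v < w → w ≤ y → Consecutive Q (vtx v) (vtx w) → ∃[ t ] Fits v w t) →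
    ∃[ j ] Σ[ ts ∈ Forest m N j ] FitsF Q u y ts
  build-forest fuel {Q} {u} {y} y≤ u≤y y<N u∈ y∈ child with m≤n⇒m<n∨m≡n u≤y
  ... | inj₂ refl = 0 , [] , []
  build-forest zero y≤ u≤y y<N u∈ y∈ child | inj₁ u<y = contradiction y≤ (<⇒≱ u<y)
  build-forest (suc fuel) {Q} {u} {y} y≤ u≤y y<N u∈ y∈ child | inj₁ u<y
    with next-corner {Q} {u} {y} u∈ y∈ u<y y<N
  ... | v , u<v , v≤y , uv with child ≤-refl u<v v≤y uv
    | build-forest fuel {Q} {v} {y}
        (≤-trans y≤ (subst (_≤ fuel + v) (+-suc fuel u) (+-monoʳ-≤ fuel u<v))) v≤y y<N (proj₁ (proj₂ uv)) y∈
        (λ v≤ → child (≤-trans (<⇒≤ u<v) v≤))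
  ... | t , ft | j , ts , fts = suc j , t ∷ ts , (uv , ft) ∷ fts

  -- `fuel` bounds the width y - x. It drops at every child, because by its third vertex Q has no
  -- other side from x to y.
  build : ∀ fuel {x y} → y ≤ fuel + x → x < y → y < N → Edge noncrossing (vtx x) (vtx y) → ∃[ t ] Fits x y t
  build zero y≤ x<y y<N edge = contradiction y≤ (<⇒≱ x<y)
  build (suc fuel) {x} {y} y≤ x<y y<N edge with m≤n⇒m<n∨m≡n x<y
  ... | inj₂ refl = leaf , leaf
  ... | inj₁ sx<y = assemble forest
    where
    x<N = <-trans x<y y<N
    x<y′ : vtx x Fin.< vtx y
    x<y′ = subst₂ _<_ (sym (toℕ-vtx x<N)) (sym (toℕ-vtx y<N)) x<y
    S : Subset N
    S = below diag? diag-sym (proj₁ ∘ diagonal) noncrossing x<y′ edge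
    yx : Consecutive S (vtx y) (vtx x)
    yx = below-consecutive diag? diag-sym (proj₁ ∘ diagonal) noncrossing x<y′ edge
    sub : Subgon S
    sub = below-subgon diag? diag-sym (proj₁ ∘ diagonal) noncrossing x<y′ edge {vtx (suc x)}
      (subst₂ _<_ (sym (toℕ-vtx x<N)) (sym (toℕ-vtx (<-trans sx<y y<N))) ≤-refl)
      (subst₂ _<_ (sym (toℕ-vtx (<-trans sx<y y<N))) (sym (toℕ-vtx y<N)) sx<y)
    narrower : ∀ {v w} → x ≤ v → w ≤ y → Consecutive S (vtx v) (vtx w) → w ≤ fuel + v
    narrower {v} {w} x≤v w≤y vw with m≤n⇒m<n∨m≡n x≤v
    ... | inj₁ x<v  = ≤-trans w≤y (≤-trans y≤ (subst (_≤ fuel + v) (+-suc fuel x) (+-monoʳ-≤ fuel x<v)))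
    ... | inj₂ refl = ≤-pred (≤-trans (≤∧≢⇒< w≤y (not-whole {S} {x} {y} {w} sub yx vw)) y≤)
    forest : ∃[ j ] Σ[ ts ∈ Forest m N j ] FitsF S x y ts
    forest = build-forest (suc fuel) y≤ (<⇒≤ x<y) y<N (proj₁ (proj₂ yx)) (proj₁ yx)
      (λ x≤v v<w w≤y vw → build fuel (narrower x≤v w≤y vw) v<w (≤-<-trans w≤y y<N) (bounded sub _ _ vw))
    assemble : ∃[ j ] Σ[ ts ∈ Forest m N j ] FitsF S x y ts → ∃[ t ] Fits x y t
    assemble (j , ts , fts) with forest-size fts x<y y<N sub yx
    assemble (_ , t ∷ ts , fts) | refl = node S t ts , node sub yx fts

-- The sweep of the rotated angulation.

turnForward : ∀ {n} → Subset n → Subset n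
turnForward Q = Vec.tabulate (lookup Q ∘ next)

turnBack-turnForward : ∀ {n} (Q : Subset n) → turnBack (turnForward Q) ≡ Q
turnBack-turnForward Q = trans
  (Vec.tabulate-cong λ i → trans (Vec.lookup∘tabulate _ (prev i)) (cong (lookup Q) (next-prev i)))
  (Vec.tabulate∘lookup Q)

turnForward-turnBack : ∀ {n} (Q : Subset n) → turnForward (turnBack Q) ≡ Q
turnForward-turnBack Q = trans
  (Vec.tabulate-cong λ i → trans (Vec.lookup∘tabulate _ (next i)) (cong (lookup Q) (prev-next i)))
  (Vec.tabulate∘lookup Q)

turnBack-injective : ∀ {n} {P Q : Subset n} → turnBack P ≡ turnBack Q → P ≡ Q
turnBack-injective {P = P} {Q} eq =
  trans (sym (turnForward-turnBack P)) (trans (cong turnForward eq) (turnForward-turnBack Q))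

module _ {N : ℕ} where

  consecutive-turnBack : ∀ {Q : Subset N} {a b} → Consecutive Q a b → Consecutive (turnBack Q) (next a) (next b)
  consecutive-turnBack {Q} {a} {b} con =
    consecutive-next (subst₂ (Consecutive Q) (sym (prev-next a)) (sym (prev-next b)) con)

  consecutive-turnForward : ∀ {Q : Subset N} {a b} →
    Consecutive Q (next a) (next b) → Consecutive (turnForward Q) a b
  consecutive-turnForward {Q} {a} {b} con = subst₂ (Consecutive (turnForward Q)) (prev-next a) (prev-next b)
    (consecutive-prev (subst (λ P → Consecutive P (next a) (next b)) (sym (turnBack-turnForward Q)) con))

  consecutive-turnForward⁻ : ∀ {Q : Subset N} {a b} →
    Consecutive (turnForward Q) a b → Consecutive Q (next a) (next b)
  consecutive-turnForward⁻ {Q} {a} {b} con =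
    subst (λ P → Consecutive P (next a) (next b)) (turnBack-turnForward Q) (consecutive-turnBack con)

  ∈-turnForward⁻ : ∀ {Q : Subset N} {x} → x ∈ turnForward Q → next x ∈ Q
  ∈-turnForward⁻ {Q} {x} x∈ = subst (next x ∈_) (turnBack-turnForward Q) (next-∈-turnBack x∈)

  side-prev : ∀ {a b : Fin N} → Side (next a) (next b) → Side a b
  side-prev = Sum.map cancel cancel
    where
    cancel : ∀ {a b : Fin N} → next b ≡ next (next a) → b ≡ next a
    cancel {a} {b} eq = trans (sym (prev-next b)) (trans (cong prev eq) (prev-next (next a)))

  turnForward-subgon : ∀ {D : Rel (Fin N) 0ℓ} {Q} → IsSubgon D Q → IsSubgon (rotated D) (turnForward Q)
  turnForward-subgon {D} {Q} (mkIsSubgon nd bd uc) = mkIsSubgon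
    (subst (3 ≤_) (trans (cong ∣_∣ (sym (turnBack-turnForward Q))) (∣turnBack∣ (turnForward Q))) nd)
    (λ a b con → Sum.map side-prev id (bd (next a) (next b) (consecutive-turnForward⁻ con)))
    (λ a b a∈ b∈ d → Sum.map consecutive-turnForward consecutive-turnForward
      (uc (next a) (next b) (∈-turnForward⁻ a∈) (∈-turnForward⁻ b∈) d))

module _ {m N : ℕ} {φ : Subset N → Subset N} (φ-injective : ∀ {P Q} → φ P ≡ φ Q → P ≡ Q) where

  occ-map : ∀ S xs → occ (φ S) (map φ xs) ≡ occ S xs
  occ-map S [] = refl
  occ-map S (Q ∷ xs) with S ≟ˢᵘᵇ Q
  ... | yes refl = trans (occ-here (φ S) (map φ xs)) (cong suc (occ-map S xs))
  ... | no S≢Q   = trans (occ-skip (map φ xs) (S≢Q ∘ φ-injective)) (occ-map S xs)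

  -- A letter depends only on which entries of the list are equal.
  transcribe-map : ∀ seen xs → transcribe m (map φ seen) (map φ xs) ≡ transcribe m seen xs
  transcribe-map seen []       = refl
  transcribe-map seen (Q ∷ xs) =
    cong₂ _++_ (cong (letter m) (occ-map Q seen)) (transcribe-map (Q ∷ seen) xs)

module _ {n : ℕ} {A B : Set} (φ : A → B) {f : Fin (suc n) → Fin (suc n) → List A}
         {g : Fin (suc n) → Fin (suc n) → List B} (φf≡g : ∀ a i → map φ (f a i) ≡ g (next a) (next i)) where

  map-turnAt : ∀ i j → map φ (turnAt f i j) ≡ turnAt g (suc i) j
  map-turnAt i zero    = refl
  map-turnAt i (suc j) = trans (map-++ φ (f (vtx (i + suc j)) (vtx i)) _)
    (cong₂ _++_ (φf≡g (vtx (i + suc j)) (vtx i)) (map-turnAt i j))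

  map-turns : ∀ i c → map φ (turns f i c) ≡ turns g (suc i) c
  map-turns i zero    = refl
  map-turns i (suc c) = trans (map-++ φ (turnAt f i n) _) (cong₂ _++_ (map-turnAt i n) (map-turns (suc i) c))

module _ {m n : ℕ} (T : Angulation m (suc n)) where
  open Sweep T
  private
    module σT = Sweep (σ T)

  -- Both lists have at most one member, so it is enough to match members; `turnBack` need not
  -- respect the order of `subsets`.
  map-at : ∀ a i → map turnBack (σT.at a i) ≡ at (next a) (next i)
  map-at a i = sym (unique-≡ at-unique (Unique.map⁺ turnBack-injective σT.at-unique) at-subsingleton to from)
    where
    to : ∀ {Q} → Q List.∈ at (next a) (next i) → Q List.∈ map turnBack (σT.at a i)
    to {Q} Q∈ = let sub , con = ∈-at⁻ Q∈ in subst (List._∈ map turnBack (σT.at a i)) (turnBack-turnForward Q)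
      (∈-map⁺ turnBack (σT.∈-at⁺ (turnForward-subgon sub) (consecutive-turnForward con)))
    from : ∀ {Q} → Q List.∈ map turnBack (σT.at a i) → Q List.∈ at (next a) (next i)
    from Q∈ with ∈-map⁻ turnBack Q∈
    ... | P , P∈ , refl = let sub , con = σT.∈-at⁻ P∈ in ∈-at⁺ (turnBack-subgon sub) (consecutive-turnBack con)

  brow-σ-turns : brow (σ T) ≡ transcribe m [] (turns at 1 (suc n))
  brow-σ-turns = begin
      brow (σ T)
    ≡⟨ σT.brow-turns ⟩
      transcribe m [] (turns σT.at 0 (suc n))
    ≡⟨ transcribe-map {m} turnBack-injective [] (turns σT.at 0 (suc n)) ⟨
      transcribe m [] (map turnBack (turns σT.at 0 (suc n)))
    ≡⟨ cong (transcribe m []) (map-turns turnBack map-at 0 (suc n)) ⟩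
      transcribe m [] (turns at 1 (suc n))
    ∎
    where open ≡-Reasoning

  module _ {t : Tree m (suc n)} (fits : Fits 0 n t) where

    turns-visits : turns at 0 (suc n) ≡ visits t
    turns-visits = begin
      rest 0 n n              ≡⟨ cong (rest 0 n) (+-identityʳ n) ⟨
      rest 0 n (n + 0)        ≡⟨ rest-visits fits ≤-refl refl (+-comm n 1) ⟩
      visits t ++ rest n 1 0  ≡⟨ cong (visits t ++_) end ⟩
      visits t ++ []          ≡⟨ ++-identityʳ (visits t) ⟩
      visits t                ∎
      where
      open ≡-Reasoning
      -- The one position left lies beyond the root edge, which is a side of P_N.
      end : rest n 1 0 ≡ []
      end = trans (++-identityʳ _) (trans (++-identityʳ _)
        (trans (cong (λ k → at (vtx k) (vtx n)) (+-comm n 1)) (at-next (vtx n))))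

    turns-rotated : turns at 1 (suc n) ≡ offspine t ++ spine t
    turns-rotated = begin
      turns at 1 (suc n)                  ≡⟨ turns-snoc at 1 n ⟩
      turns at 1 n ++ turnAt at (n + 1) n ≡⟨ cong (λ k → turns at 1 n ++ turnAt at k n) (+-comm n 1) ⟩
      turns at 1 n ++ turnAt at (suc n) n ≡⟨ cong (turns at 1 n ++_) (turnAt-period at n) ⟩
      turns at 1 n ++ turnAt at 0 n       ≡⟨ cong₂ _++_ rest≡ first≡ ⟩
      offspine t ++ spine t               ∎
      where
      open ≡-Reasoning
      first≡ : turnAt at 0 n ≡ spine t
      first≡ = turnAt-spine fits ≤-refl refl
      rest≡ : turns at 1 n ≡ offspine t
      -- The full sweep from v_0 is already known to be `spine t ++ offspine t`, and its first turn
      -- is `spine t`; cancelling that turn leaves the others.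
      rest≡ = ++-cancelˡ (spine t) _ _ (trans (cong (_++ turns at 1 n) (sym first≡))
        (trans turns-visits (spine-offspine t)))

    brow-word : brow T ≡ word t
    brow-word = trans brow-turns (trans (cong (transcribe m []) turns-visits)
      (transcribe-visits t (labels-unique fits ≤-refl) λ _ → refl))

-- The root edge and the conclusion.

module _ {k ℓ n : ℕ} (N≡ : suc n ≡ suc k * suc ℓ + 2) (T : Angulation (suc k) (suc n)) where
  open Sweep T

  private
    n≡ : n ≡ suc (suc k * suc ℓ)
    n≡ = suc-injective (trans N≡ (+-comm _ 2))

  size-root : ∀ {t} → Fits 0 n t → size t ≡ suc ℓ
  size-root {t} fits = *-cancelˡ-≡ (size t) (suc ℓ) (suc k)
    (suc-injective (trans (sym (+-identityʳ _)) (trans (sym (fits-size fits)) n≡)))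

  root : ∃[ t ] Fits 0 n t
  root = build n (≤-reflexive (sym (+-identityʳ n))) (subst (0 <_) (sym n≡) (s≤s z≤n)) ≤-refl
    -- The root edge is a side because v_0 comes after v_n: index N = n + 1 denotes v_0 again.
    (inj₁ (inj₂ (sym (vtx-period 0))))

  brow-dyck : IsDyckPath (suc k) (suc ℓ) (brow T)
  brow-dyck = subst (IsDyckPath (suc k) (suc ℓ)) (sym (brow-word T fits)) record
    { right-steps  = trans (#R-word t) (cong (suc k *_) (size-root fits))
    ; up-steps     = trans (#U-word t) (size-root fits)
    ; weakly-above = climb-above {a = 0} (climb-word t)
    }
    where
    t = proj₁ root
    fits = proj₂ root

  brow-rotation : brow (σ T) ≡ rot (suc k) (brow T)
  brow-rotation = rotation (proj₁ root) (proj₂ root)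
    where
    open ≡-Reasoning
    rotation : ∀ t → Fits 0 n t → brow (σ T) ≡ rot (suc k) (brow T)
    rotation leaf fits = contradiction (size-root fits) λ ()
    rotation t@(node Q t₁ ts) fits = begin
      brow (σ T)                                           ≡⟨ brow-σ-turns T ⟩
      transcribe (suc k) [] (turns at 1 (suc n))           ≡⟨ cong (transcribe (suc k) []) (turns-rotated T fits) ⟩
      transcribe (suc k) [] (offspine t ++ spine t)        ≡⟨ transcribe-rotated t (labels-unique fits ≤-refl) ⟩
      concatMap (λ B → U ∷ B ++ [ R ]) (blocks t)          ≡⟨ rot-word Q t₁ ts ⟨
      rot (suc k) (word t)                                 ≡⟨ cong (rot (suc k)) (brow-word T fits) ⟨
      rot (suc k) (brow T)                                 ∎

theorem5p12 : ∀ {m ℓ N : ℕ} → 1 ≤ m → 1 ≤ ℓ → N ≡ m * ℓ + 2 →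
    (T : Angulation m N) →
    IsDyckPath m ℓ (brow T) × brow (σ T) ≡ rot m (brow T)
theorem5p12 {N = suc n} (s≤s _) (s≤s _) N≡ T = brow-dyck N≡ T , brow-rotation N≡ T
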